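{- Suppose $k\ge 4$ is even. Let $L$ be an irredundant $2\times k$ linear system with girth $s(L)=k-1$. Then there exists $p_L$ such that $L$ is uncommon over $\mathbb{F}_p$ for all primes $p\ge p_L$.
   Context: An $m\times k$ linear system $L$ is a collection of $m$ homogeneous linear equations in $k$ variables with integer coefficients, identified with its coefficient matrix $L\in\mathbb{Z}^{m\times k}$ (equations $L\mathbf{x}=0$). Row spans are taken over $\mathbb{Q}$. $L$ is irredundant if: (1) its rows are linearly independent; (2) no column of $L$ is zero; (3) the row span of $L$ contains no vector having one entry $1$, one entry $-1$ and all other entries $0$. The girth $s(L)$ is the minimum size of the support of a nonzero vector in the row span of $L$. For a prime $p$, $n\in\mathbb{N}$ and $f:\mathbb{F}_p^n\to\mathbb{R}$, let $t_L(f)=\mathbb{E}_{\mathbf{x}\in(\mathbb{F}_p^n)^k:\,L\mathbf{x}=0}\,f(x_1)\cdots f(x_k)$ (average over all solutions). An irredundant $m\times k$ system $L$ is common over $\mathbb{F}_p$ if for all $n\in\mathbb{N}$ and all $f:\mathbb{F}_p^n\to[0,1]$ one has $t_L(f)+t_L(1-f)\ge 2^{1-k}$; otherwise $L$ is uncommon over $\mathbb{F}_p$. -}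

module Defs where

open import Data.Fin using (Fin; toℕ)
open import Data.Fin.Properties using (all?)
open import Data.Fin.Subset using (Subset; ∣_∣)
open import Data.Integer as ℤ using (ℤ; +_)
open import Data.Integer.Divisibility.Signed using (_∣_; _∣?_)
import Data.Integer.Properties as ℤ
open import Data.List as List using (List; []; _∷_)
open import Data.Nat as ℕ using (ℕ; zero; suc)
import Data.Nat.Properties as ℕ
open import Data.Product using (∃-syntax; _×_; _,_)
open import Data.Rational as ℚ using (ℚ; 0ℚ; 1ℚ; ½)
import Data.Rational.Properties as ℚ
open import Data.Rational.Solver using (module +-*-Solver)
open import Data.Vec as Vec using (Vec; lookup; tabulate)
open import Data.Vec.Functional using (Vector)
open import Relation.Binary.PropositionalEquality using (_≡_; _≢_; refl; sym; trans; cong; cong₂; subst)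
open import Relation.Nullary using (¬_; Dec; ¬?; does)

open import Algebra.Properties.CommutativeMonoid.Sum ℤ.+-0-commutativeMonoid using () renaming (sum to sumℤ)
open import Algebra.Properties.CommutativeMonoid.Sum ℚ.+-0-commutativeMonoid using () renaming (sum to sumℚ)

-- A real number is represented by a Cauchy sequence of rationals.  Two
-- sequences represent the same real when each is ≤ the other; everything
-- below uses reals only through the ring operations and _≤ᴿ_, so this
-- equality is never needed.

IsCauchy : (ℕ → ℚ) → Set
IsCauchy s = ∀ ε → 0ℚ ℚ.< ε → ∃[ N ] (∀ m n → N ℕ.≤ m → N ℕ.≤ n → ℚ.∣ s m ℚ.- s n ∣ ℚ.< ε)

record ℝ : Set where
  constructor mkℝ
  field
    seq    : ℕ → ℚ
    cauchy : IsCauchy seq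

open ℝ public

private
  halves : ∀ ε → ½ ℚ.* ε ℚ.+ ½ ℚ.* ε ≡ ε
  halves ε = trans (sym (ℚ.*-distribʳ-+ ε ½ ½)) (ℚ.*-identityˡ ε)

  half-pos : ∀ ε → 0ℚ ℚ.< ε → 0ℚ ℚ.< ½ ℚ.* ε
  half-pos ε 0<ε = ℚ.positive⁻¹ _ {{ℚ.pos*pos⇒pos ½ ε {{ℚ.positive 0<ε}}}}

  +-cauchy : ∀ {s t} → IsCauchy s → IsCauchy t → IsCauchy (λ n → s n ℚ.+ t n)
  +-cauchy {s} {t} cs ct ε 0<ε with cs (½ ℚ.* ε) (half-pos ε 0<ε) | ct (½ ℚ.* ε) (half-pos ε 0<ε)
  ... | N₁ , h₁ | N₂ , h₂ = N₁ ℕ.⊔ N₂ , λ m n N≤m N≤n → begin-strict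
      ℚ.∣ (s m ℚ.+ t m) ℚ.- (s n ℚ.+ t n) ∣
        ≡⟨ cong ℚ.∣_∣ (rearrange (s m) (t m) (s n) (t n)) ⟩
      ℚ.∣ (s m ℚ.- s n) ℚ.+ (t m ℚ.- t n) ∣
        ≤⟨ ℚ.∣p+q∣≤∣p∣+∣q∣ (s m ℚ.- s n) (t m ℚ.- t n) ⟩
      ℚ.∣ s m ℚ.- s n ∣ ℚ.+ ℚ.∣ t m ℚ.- t n ∣
        <⟨ ℚ.+-mono-< (h₁ m n (ℕ.m⊔n≤o⇒m≤o N₁ N₂ N≤m) (ℕ.m⊔n≤o⇒m≤o N₁ N₂ N≤n))
                      (h₂ m n (ℕ.m⊔n≤o⇒n≤o N₁ N₂ N≤m) (ℕ.m⊔n≤o⇒n≤o N₁ N₂ N≤n)) ⟩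
      ½ ℚ.* ε ℚ.+ ½ ℚ.* ε
        ≡⟨ halves ε ⟩
      ε ∎
    where
    open ℚ.≤-Reasoning
    open +-*-Solver
    rearrange : ∀ a b c d → (a ℚ.+ b) ℚ.- (c ℚ.+ d) ≡ (a ℚ.- c) ℚ.+ (b ℚ.- d)
    rearrange = solve 4 (λ a b c d → (a :+ b) :- (c :+ d) := (a :- c) :+ (b :- d)) refl

  neg-cauchy : ∀ {s} → IsCauchy s → IsCauchy (λ n → ℚ.- s n)
  neg-cauchy {s} cs ε 0<ε with cs ε 0<ε
  ... | N , h = N , λ m n N≤m N≤n → subst (ℚ._< ε) (eq m n) (h m n N≤m N≤n)
    where
    open +-*-Solver
    eq : ∀ m n → ℚ.∣ s m ℚ.- s n ∣ ≡ ℚ.∣ (ℚ.- s m) ℚ.- (ℚ.- s n) ∣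
    eq m n = trans (sym (ℚ.∣-p∣≡∣p∣ (s m ℚ.- s n)))
                   (cong ℚ.∣_∣ (solve 2 (λ a b → :- (a :- b) := (:- a) :- (:- b)) refl (s m) (s n)))

  const-cauchy : ∀ q → IsCauchy (λ _ → q)
  const-cauchy q ε 0<ε = 0 , λ _ _ _ _ → subst (ℚ._< ε) (sym (cong ℚ.∣_∣ (ℚ.+-inverseʳ q))) 0<ε

  bounded : ∀ {s} → IsCauchy s → ∃[ B ] (0ℚ ℚ.< B × ∃[ N ] (∀ n → N ℕ.≤ n → ℚ.∣ s n ∣ ℚ.≤ B))
  bounded {s} cs with cs 1ℚ (ℚ.positive⁻¹ 1ℚ)
  ... | N , h = 1ℚ ℚ.+ ℚ.∣ s N ∣
              , ℚ.+-mono-<-≤ (ℚ.positive⁻¹ 1ℚ) (ℚ.0≤∣p∣ (s N))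
              , N
              , λ n N≤n → begin
      ℚ.∣ s n ∣
        ≡⟨ cong ℚ.∣_∣ (solve 2 (λ a b → a := (a :- b) :+ b) refl (s n) (s N)) ⟩
      ℚ.∣ (s n ℚ.- s N) ℚ.+ s N ∣
        ≤⟨ ℚ.∣p+q∣≤∣p∣+∣q∣ (s n ℚ.- s N) (s N) ⟩
      ℚ.∣ s n ℚ.- s N ∣ ℚ.+ ℚ.∣ s N ∣
        ≤⟨ ℚ.+-monoˡ-≤ ℚ.∣ s N ∣ (ℚ.<⇒≤ (h n N N≤n ℕ.≤-refl)) ⟩
      1ℚ ℚ.+ ℚ.∣ s N ∣ ∎
    where
    open ℚ.≤-Reasoning
    open +-*-Solver

  -- δ with B δ = ε / 2
  shrink : ∀ B → 0ℚ ℚ.< B → ∀ ε → 0ℚ ℚ.< ε → ∃[ δ ] (0ℚ ℚ.< δ × B ℚ.* δ ≡ ½ ℚ.* ε)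
  shrink B 0<B ε 0<ε = (ℚ.1/ B) ℚ.* (½ ℚ.* ε)
                     , ℚ.positive⁻¹ _ {{ℚ.pos*pos⇒pos (ℚ.1/ B) {{ℚ.1/pos⇒pos B}} (½ ℚ.* ε) {{ℚ.positive (half-pos ε 0<ε)}}}}
                     , trans (sym (ℚ.*-assoc B (ℚ.1/ B) (½ ℚ.* ε)))
                             (trans (cong (ℚ._* (½ ℚ.* ε)) (ℚ.*-inverseʳ B)) (ℚ.*-identityˡ _))
    where
    instance
      B-pos : ℚ.Positive B
      B-pos = ℚ.positive 0<B
      B-nonZero : ℚ.NonZero B
      B-nonZero = ℚ.pos⇒nonZero B

  ∣*∣-bound : ∀ {p q B δ} → 0ℚ ℚ.< B → ℚ.∣ p ∣ ℚ.≤ B → ℚ.∣ q ∣ ℚ.< δ → ℚ.∣ p ℚ.* q ∣ ℚ.< B ℚ.* δ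
  ∣*∣-bound {p} {q} {B} {δ} 0<B p≤B q<δ = begin-strict
      ℚ.∣ p ℚ.* q ∣
        ≡⟨ ℚ.∣p*q∣≡∣p∣*∣q∣ p q ⟩
      ℚ.∣ p ∣ ℚ.* ℚ.∣ q ∣
        ≤⟨ ℚ.*-monoʳ-≤-nonNeg ℚ.∣ q ∣ {{ℚ.∣-∣-nonNeg q}} p≤B ⟩
      B ℚ.* ℚ.∣ q ∣
        <⟨ ℚ.*-monoʳ-<-pos B {{ℚ.positive 0<B}} q<δ ⟩
      B ℚ.* δ ∎
    where open ℚ.≤-Reasoning

  product-close : ∀ {A B α β ε} a b c d → 0ℚ ℚ.< A → 0ℚ ℚ.< B →
    ℚ.∣ a ∣ ℚ.≤ A → ℚ.∣ d ∣ ℚ.≤ B → ℚ.∣ b ℚ.- d ∣ ℚ.< α → ℚ.∣ a ℚ.- c ∣ ℚ.< β →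
    A ℚ.* α ≡ ½ ℚ.* ε → B ℚ.* β ≡ ½ ℚ.* ε → ℚ.∣ a ℚ.* b ℚ.- c ℚ.* d ∣ ℚ.< ε
  product-close {A} {B} {α} {β} {ε} a b c d 0<A 0<B a≤A d≤B b-d<α a-c<β Aα Bβ = begin-strict
      ℚ.∣ a ℚ.* b ℚ.- c ℚ.* d ∣
        ≡⟨ cong ℚ.∣_∣ (rearrange a b c d) ⟩
      ℚ.∣ a ℚ.* (b ℚ.- d) ℚ.+ d ℚ.* (a ℚ.- c) ∣
        ≤⟨ ℚ.∣p+q∣≤∣p∣+∣q∣ (a ℚ.* (b ℚ.- d)) (d ℚ.* (a ℚ.- c)) ⟩
      ℚ.∣ a ℚ.* (b ℚ.- d) ∣ ℚ.+ ℚ.∣ d ℚ.* (a ℚ.- c) ∣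
        <⟨ ℚ.+-mono-< (∣*∣-bound {a} {b ℚ.- d} {A} {α} 0<A a≤A b-d<α)
                      (∣*∣-bound {d} {a ℚ.- c} {B} {β} 0<B d≤B a-c<β) ⟩
      A ℚ.* α ℚ.+ B ℚ.* β
        ≡⟨ cong₂ ℚ._+_ Aα Bβ ⟩
      ½ ℚ.* ε ℚ.+ ½ ℚ.* ε
        ≡⟨ halves ε ⟩
      ε ∎
    where
    open ℚ.≤-Reasoning
    open +-*-Solver
    rearrange : ∀ a b c d → a ℚ.* b ℚ.- c ℚ.* d ≡ a ℚ.* (b ℚ.- d) ℚ.+ d ℚ.* (a ℚ.- c)
    rearrange = solve 4 (λ a b c d → a :* b :- c :* d := a :* (b :- d) :+ d :* (a :- c)) refl

  *-cauchy : ∀ {s t} → IsCauchy s → IsCauchy t → IsCauchy (λ n → s n ℚ.* t n)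
  *-cauchy {s} {t} cs ct ε 0<ε =
    let A , 0<A , M₁ , s≤A = bounded {s} cs
        B , 0<B , M₂ , t≤B = bounded {t} ct
        α , 0<α , Aα = shrink A 0<A ε 0<ε
        β , 0<β , Bβ = shrink B 0<B ε 0<ε
        N₁ , h₁ = ct α 0<α
        N₂ , h₂ = cs β 0<β
        M = M₁ ℕ.⊔ M₂
        N = N₁ ℕ.⊔ N₂
    in M ℕ.⊔ N , λ m n ≤m ≤n →
      product-close (s m) (t m) (s n) (t n) 0<A 0<B
        (s≤A m (ℕ.m⊔n≤o⇒m≤o M₁ M₂ (ℕ.m⊔n≤o⇒m≤o M N ≤m)))
        (t≤B n (ℕ.m⊔n≤o⇒n≤o M₁ M₂ (ℕ.m⊔n≤o⇒m≤o M N ≤n)))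
        (h₁ m n (ℕ.m⊔n≤o⇒m≤o N₁ N₂ (ℕ.m⊔n≤o⇒n≤o M N ≤m)) (ℕ.m⊔n≤o⇒m≤o N₁ N₂ (ℕ.m⊔n≤o⇒n≤o M N ≤n)))
        (h₂ m n (ℕ.m⊔n≤o⇒n≤o N₁ N₂ (ℕ.m⊔n≤o⇒n≤o M N ≤m)) (ℕ.m⊔n≤o⇒n≤o N₁ N₂ (ℕ.m⊔n≤o⇒n≤o M N ≤n)))
        Aα Bβ

infixl 6 _+ᴿ_ _-ᴿ_
infixl 7 _*ᴿ_
infix  4 _≤ᴿ_

fromℚ : ℚ → ℝ
fromℚ q = mkℝ (λ _ → q) (const-cauchy q)

0ᴿ 1ᴿ : ℝ
0ᴿ = fromℚ 0ℚ
1ᴿ = fromℚ 1ℚ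

_+ᴿ_ _-ᴿ_ _*ᴿ_ : ℝ → ℝ → ℝ
mkℝ x cx +ᴿ mkℝ y cy = mkℝ (λ n → x n ℚ.+ y n) (+-cauchy {x} {y} cx cy)
mkℝ x cx -ᴿ mkℝ y cy = mkℝ (λ n → x n ℚ.- y n) (+-cauchy {x} {λ n → ℚ.- y n} cx (neg-cauchy {y} cy))
mkℝ x cx *ᴿ mkℝ y cy = mkℝ (λ n → x n ℚ.* y n) (*-cauchy {x} {y} cx cy)

_≤ᴿ_ : ℝ → ℝ → Set
x ≤ᴿ y = ∀ ε → 0ℚ ℚ.< ε → ∃[ N ] (∀ n → N ℕ.≤ n → seq x n ℚ.≤ seq y n ℚ.+ ε)

sumᴿ productᴿ : List ℝ → ℝ
sumᴿ     = List.foldr _+ᴿ_ 0ᴿ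
productᴿ = List.foldr _*ᴿ_ 1ᴿ

-- The value on the empty list is a dummy: averages are only taken below
-- over solution sets, which contain the zero vector.
average : List ℝ → ℝ
average []       = 0ᴿ
average (x ∷ xs) = fromℚ (+ 1 ℚ./ suc (List.length xs)) *ᴿ sumᴿ (x ∷ xs)

LinearSystem : ℕ → ℕ → Set
LinearSystem m k = Fin m → Fin k → ℤ

fromℤ : ℤ → ℚ
fromℤ z = z ℚ./ 1

rowCombination : ∀ {m k} → LinearSystem m k → Vector ℚ m → Vector ℚ k
rowCombination L c j = sumℚ (λ i → c i ℚ.* fromℤ (L i j))

InRowSpan : ∀ {m k} → LinearSystem m k → Vector ℚ k → Set
InRowSpan L v = ∃[ c ] (∀ j → v j ≡ rowCombination L c j)

-- i ≢ j is automatic, since 1 ≢ -1.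
IsDifference : ∀ {k} → Vector ℚ k → Set
IsDifference v = ∃[ i ] ∃[ j ] (v i ≡ 1ℚ × v j ≡ ℚ.- 1ℚ × (∀ l → l ≢ i → l ≢ j → v l ≡ 0ℚ))

record Irredundant {m k} (L : LinearSystem m k) : Set where
  field
    rows-independent : ∀ c → (∀ j → rowCombination L c j ≡ 0ℚ) → ∀ i → c i ≡ 0ℚ
    columns-nonzero  : ∀ j → ¬ (∀ i → L i j ≡ + 0)
    no-difference    : ∀ v → InRowSpan L v → ¬ IsDifference v

support : ∀ {k} → Vector ℚ k → Subset k
support v = tabulate (λ j → does (¬? (v j ℚ.≟ 0ℚ)))

NonzeroRowSpanVector : ∀ {m k} → LinearSystem m k → Vector ℚ k → Set
NonzeroRowSpanVector L v = InRowSpan L v × ¬ (∀ j → v j ≡ 0ℚ)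

HasGirth : ∀ {m k} → LinearSystem m k → ℕ → Set
HasGirth L s = (∃[ v ] (NonzeroRowSpanVector L v × ∣ support v ∣ ≡ s))
             × (∀ v → NonzeroRowSpanVector L v → s ℕ.≤ ∣ support v ∣)

-- Elements of 𝔽_p are represented by their residues 0, …, p - 1, so an
-- integer linear equation holds in 𝔽_p when p divides its left-hand side
-- evaluated at the residues.
𝔽^ : ℕ → ℕ → Set
𝔽^ p n = Vec (Fin p) n

IsSolution : ∀ {m k p n} → LinearSystem m k → Vec (𝔽^ p n) k → Set
IsSolution {p = p} L x = ∀ i c → + p ∣ sumℤ (λ j → L i j ℤ.* + toℕ (lookup (lookup x j) c))

isSolution? : ∀ {m k p n} (L : LinearSystem m k) (x : Vec (𝔽^ p n) k) → Dec (IsSolution L x)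
isSolution? {p = p} L x = all? (λ i → all? (λ c → + p ∣? sumℤ (λ j → L i j ℤ.* + toℕ (lookup (lookup x j) c))))

-- All vectors with entries from the given list; applied to duplicate-free
-- lists, so that each vector occurs exactly once.
allVecs : ∀ {A : Set} → List A → ∀ n → List (Vec A n)
allVecs xs zero    = Vec.[] ∷ []
allVecs xs (suc n) = List.cartesianProductWith Vec._∷_ xs (allVecs xs n)

solutions : ∀ {m k} → LinearSystem m k → ∀ p n → List (Vec (𝔽^ p n) k)
solutions {k = k} L p n = List.filter (isSolution? L) (allVecs (allVecs (List.allFin p) n) k)

t : ∀ {m k} → LinearSystem m k → ∀ {p n} → (𝔽^ p n → ℝ) → ℝ
t L {p} {n} f = average (List.map (λ x → productᴿ (Vec.toList (Vec.map f x))) (solutions L p n))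

2^[1-_] : ℕ → ℚ
2^[1- k ] = (+ 2 ℚ./ (2 ℕ.^ k)) {{ℕ.m^n≢0 2 k}}

Common : ∀ {m k} → ℕ → LinearSystem m k → Set
Common {k = k} p L =
  ∀ n (f : 𝔽^ p n → ℝ) → (∀ a → 0ᴿ ≤ᴿ f a × f a ≤ᴿ 1ᴿ) →
  fromℚ 2^[1- k ] ≤ᴿ t L f +ᴿ t L (λ a → 1ᴿ -ᴿ f a)

Uncommon : ∀ {m k} → ℕ → LinearSystem m k → Set
Uncommon p L = ¬ Common p L

module Submission where

-- Write a function with values in [0,1] as (D + g) / 2D with g of mean zero.
-- Any k - 2 coordinates of a random solution are independent and uniform, and
-- products of an odd number of coordinates cancel between g and -g; as k is
-- even, t(f) + t(1 - f) - 2^(1-k) has the sign of the sum of g(x₁) ⋯ g(x_k)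
-- over all solutions.
--
-- With u(c) = p [c = 0] - 1 on 𝔽_p and F(x) = u(x₁) + ⋯ + u(x_N), this sum is
-- negative for g(y, x) = (1 + u(y)) F(x) - p u(y) when N = p^(k-2).  Expanding
-- F, the products that mix different u(x_i) average to zero, and so do those
-- with 1 ≤ j ≤ k - 2 factors F.  The choice of N balances the terms with k
-- factors F (linear in N) against those with none (independent of N); each of
-- these two is proportional to κ = p² - 1 - k(p - 1), whereas the terms with
-- k - 1 factors F contribute -k(p - 1)² in the same normalisation, and
-- 2κ - k(p - 1)² = -(k - 2)(p² - 1) < 0.

open import Defs
open import Data.Bool using (true; false; if_then_else_)
open import Data.Empty using (⊥-elim)
open import Data.Fin as Fin using (Fin; zero; suc; toℕ; fromℕ<)
open import Data.Fin.Patterns using (0F; 1F)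
import Data.Fin.Properties as Fin
open import Data.Fin.Subset using (Subset; ∣_∣; ⊤; _∈_; _∉_) renaming (_-_ to _∖_)
open import Data.Fin.Subset.Properties using (∈⊤; ∣⊤∣≡n; p⊆q⇒∣p∣≤∣q∣; x∈p∧x≢y⇒x∈p-y; x∈p⇒∣p-x∣<∣p∣)
open import Data.Integer as ℤ using (ℤ; +_; _+_; _-_; _*_; -_)
open import Data.Integer.DivMod using (_%ℕ_; _/ℕ_; n%ℕd<d; a≡a%ℕn+[a/ℕn]*n)
open import Data.Integer.Divisibility.Signed using (divides; ∣ᵤ⇒∣; ∣⇒∣ᵤ; ∣m∣n⇒∣m+n; ∣m∣n⇒∣m-n; ∣n⇒∣m*n; ∣m⇒∣m*n)
  renaming (_∣_ to _∣ℤ_; _∣?_ to _∣ℤ?_)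
import Data.Integer.Properties as ℤ
open import Data.Integer.Tactic.RingSolver using (solve-∀)
open import Data.List as List using (List; []; _∷_; _++_)
open import Data.List.Properties using (length-map; length-tabulate)
open import Data.Nat as ℕ using (ℕ; zero; suc; _∸_; _≤_)
open import Data.Nat.Coprimality using (Coprime; coprime-Bézout)
open import Data.Nat.Divisibility as ℕ using (_∣_)
open import Data.Nat.GCD using (module Bézout)
open import Data.Nat.Primality using (Prime; euclidsLemma; prime⇒irreducible; prime⇒nonZero; prime⇒nonTrivial)
import Data.Nat.Properties as ℕ
open import Data.Product using (∃-syntax; _×_; _,_; proj₁; proj₂)
open import Data.Rational as ℚ using (ℚ; 0ℚ; 1ℚ)
import Data.Rational.Properties as ℚ
open import Data.Rational.Solver using (module +-*-Solver)
open import Data.Rational.Unnormalised as ℚᵘ using (mkℚᵘ)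
import Data.Rational.Unnormalised.Properties as ℚᵘ
open import Data.Sum using (inj₁; inj₂; [_,_]′)
open import Data.Vec as Vec using (Vec; []; _∷_; lookup; zipWith)
open import Data.Vec.Functional using (Vector; updateAt)
open import Data.Vec.Properties using (lookup-zipWith; lookup∘tabulate; []=⇒lookup)
open import Function using (_∘_; id)
open import Relation.Binary.PropositionalEquality
open import Relation.Nullary using (¬_; Dec; yes; no; does; _because_; _×-dec_; ¬?)
open import Relation.Nullary.Decidable using (dec-true; dec-false)

open import Algebra.Properties.CommutativeMonoid.Sum ℤ.*-1-commutativeMonoid using () renaming (sum to prod; sum-cong-≗ to prod-cong)
open import Algebra.Properties.Semiring.Sum ℤ.+-*-semiring using (*-distribˡ-sum; ∑-distrib-+) renaming (sum to sumℤ; sum-cong-≗ to sumℤ-cong)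

open ≡-Reasoning

-- Neither ingredient of `g` works alone: for F, or for u in one variable, the sum over solutions is
-- a positive multiple of κ = (p - 1)(p + 1 - k), which is positive once p ≥ k. Since 1 + u(y) = p
-- [y = 0], the combination is g(y, x) = p ([y = 0] F(x) - u(y)): a copy of F on the hyperplane y =
-- 0, corrected by a function of y.
--
-- In a term with k - 1 factors F, all but one of the y_i vanish. The columns are nonzero modulo p,
-- so the equations force the last y_i to vanish too, where -u(0) = -(p - 1), while the k - 1
-- factors F average to N (p - 1). This fixed sign is the source of the negative contribution. All
-- y_i vanish with probability p^-(k-2), and N = p^(k-2) compensates for exactly this.
--
-- Fractions and characters are avoided: sums over solutions replace averages, and D + g and D - g
-- replace f and 1 - f. Their products are summed directly, so the independence of k - 2 coordinates
-- enters through one closed formula for solutions in 𝔽_p.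

private variable
  A B C : Set
  k n : ℕ

-- Finite sums over lists and over lists of vectors.

∑ : List A → (A → ℤ) → ℤ
∑ []       f = + 0
∑ (x ∷ xs) f = f x + ∑ xs f

infix 5 ∑
syntax ∑ xs (λ x → e) = ∑[ x ∈ xs ] e

∑-cong : ∀ (xs : List A) {f g : A → ℤ} → (∀ x → f x ≡ g x) → ∑ xs f ≡ ∑ xs g
∑-cong []       f≗g = refl
∑-cong (x ∷ xs) f≗g = cong₂ _+_ (f≗g x) (∑-cong xs f≗g)

∑-zero : ∀ (xs : List A) → ∑ xs (λ _ → + 0) ≡ + 0
∑-zero []       = refl
∑-zero (x ∷ xs) = trans (ℤ.+-identityˡ _) (∑-zero xs)

∑-+ : ∀ (xs : List A) (f g : A → ℤ) → ∑ xs (λ x → f x + g x) ≡ ∑ xs f + ∑ xs g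
∑-+ []       f g = refl
∑-+ (x ∷ xs) f g = trans (cong (_+_ (f x + g x)) (∑-+ xs f g)) (interchange (f x) (g x) (∑ xs f) (∑ xs g))
  where
  interchange : ∀ a b c d → a + b + (c + d) ≡ a + c + (b + d)
  interchange = solve-∀

∑-*ˡ : ∀ (xs : List A) c (f : A → ℤ) → ∑ xs (λ x → c * f x) ≡ c * ∑ xs f
∑-*ˡ []       c f = sym (ℤ.*-zeroʳ c)
∑-*ˡ (x ∷ xs) c f = trans (cong (_+_ (c * f x)) (∑-*ˡ xs c f)) (sym (ℤ.*-distribˡ-+ c (f x) (∑ xs f)))

∑-++ : ∀ (xs ys : List A) f → ∑ (xs ++ ys) f ≡ ∑ xs f + ∑ ys f
∑-++ []       ys f = sym (ℤ.+-identityˡ _)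
∑-++ (x ∷ xs) ys f = trans (cong (_+_ (f x)) (∑-++ xs ys f)) (sym (ℤ.+-assoc (f x) _ _))

∑-map : ∀ (h : A → B) xs f → ∑ (List.map h xs) f ≡ ∑ xs (f ∘ h)
∑-map h []       f = refl
∑-map h (x ∷ xs) f = cong (_+_ (f (h x))) (∑-map h xs f)

∑-swap : ∀ (xs : List A) (ys : List B) (f : A → B → ℤ) →
         ∑[ x ∈ xs ] ∑[ y ∈ ys ] f x y ≡ ∑[ y ∈ ys ] ∑[ x ∈ xs ] f x y
∑-swap []       ys f = sym (∑-zero ys)
∑-swap (x ∷ xs) ys f = trans (cong (_+_ (∑ ys (f x))) (∑-swap xs ys f)) (sym (∑-+ ys (f x) _))

∑-cartesianProductWith : ∀ (h : A → B → C) xs ys f →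
  ∑ (List.cartesianProductWith h xs ys) f ≡ ∑[ x ∈ xs ] ∑[ y ∈ ys ] f (h x y)
∑-cartesianProductWith h []       ys f = refl
∑-cartesianProductWith h (x ∷ xs) ys f = trans (∑-++ (List.map (h x) ys) _ f)
  (cong₂ _+_ (∑-map (h x) ys f) (∑-cartesianProductWith h xs ys f))

∑-tabulate-point : ∀ (h : Fin n → A) (f : A → ℤ) i → (∀ j → j ≢ i → f (h j) ≡ + 0) →
                   ∑ (List.tabulate h) f ≡ f (h i)
∑-tabulate-point h f zero    f≡0 = trans (cong (_+_ (f (h zero))) (rest h f (λ j → f≡0 (suc j) λ ()))) (ℤ.+-identityʳ _)
  where
  rest : ∀ {n} (h : Fin (suc n) → A) (f : A → ℤ) → (∀ j → f (h (suc j)) ≡ + 0) → ∑ (List.tabulate (h ∘ suc)) f ≡ + 0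
  rest {n = zero}  h f f≡0 = refl
  rest {n = suc n} h f f≡0 = trans (cong₂ _+_ (f≡0 zero) (rest (h ∘ suc) f (f≡0 ∘ suc))) refl
∑-tabulate-point h f (suc i) f≡0 = trans (cong₂ _+_ (f≡0 zero λ ()) (∑-tabulate-point (h ∘ suc) f i (λ j j≢i → f≡0 (suc j) (j≢i ∘ Fin.suc-injective)))) (ℤ.+-identityˡ _)

∑-allVecs-suc : ∀ (xs : List A) n (f : Vec A (suc n) → ℤ) →
                ∑ (allVecs xs (suc n)) f ≡ ∑[ x ∈ xs ] ∑[ v ∈ allVecs xs n ] f (x ∷ v)
∑-allVecs-suc xs n f = ∑-cartesianProductWith _∷_ xs (allVecs xs n) f

-- A k-tuple of vectors of length n + 1 amounts to the k-tuple of heads and the k-tuple of tails. A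
-- linear system constrains each coordinate separately, so this is how sums over solutions are
-- peeled one coordinate at a time.
∑-transpose : ∀ (xs : List A) n k (f : Vec (Vec A (suc n)) k → ℤ) →
  ∑ (allVecs (allVecs xs (suc n)) k) f ≡
  ∑[ ξ ∈ allVecs xs k ] ∑[ x ∈ allVecs (allVecs xs n) k ] f (zipWith _∷_ ξ x)
∑-transpose xs n zero    f = sym (ℤ.+-identityʳ _)
∑-transpose xs n (suc k) f = begin
  ∑ (allVecs V′ (suc k)) f
    ≡⟨ ∑-allVecs-suc V′ k f ⟩
  (∑[ v ∈ V′ ] ∑[ w ∈ allVecs V′ k ] f (v ∷ w))
    ≡⟨ ∑-allVecs-suc xs n _ ⟩
  (∑[ a ∈ xs ] ∑[ y ∈ V ] ∑[ w ∈ allVecs V′ k ] f ((a ∷ y) ∷ w))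
    ≡⟨ ∑-cong xs (λ a → ∑-cong V (λ y → ∑-transpose xs n k _)) ⟩
  (∑[ a ∈ xs ] ∑[ y ∈ V ] ∑[ ξ ∈ allVecs xs k ] ∑[ x ∈ allVecs V k ] f ((a ∷ y) ∷ zipWith _∷_ ξ x))
    ≡⟨ ∑-cong xs (λ a → ∑-swap V (allVecs xs k) _) ⟩
  (∑[ a ∈ xs ] ∑[ ξ ∈ allVecs xs k ] ∑[ y ∈ V ] ∑[ x ∈ allVecs V k ] f ((a ∷ y) ∷ zipWith _∷_ ξ x))
    ≡⟨ ∑-cong xs (λ a → ∑-cong (allVecs xs k) (λ ξ → ∑-allVecs-suc V k _)) ⟨
  (∑[ a ∈ xs ] ∑[ ξ ∈ allVecs xs k ] ∑[ x ∈ allVecs V (suc k) ] f (zipWith _∷_ (a ∷ ξ) x))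
    ≡⟨ ∑-allVecs-suc xs k _ ⟨
  (∑[ ξ ∈ allVecs xs (suc k) ] ∑[ x ∈ allVecs V (suc k) ] f (zipWith _∷_ ξ x)) ∎
  where
  V  = allVecs xs n
  V′ = allVecs xs (suc n)

-- Indicators with values 0 and 1, and the basic notation.

⟦_⟧ : ∀ {P : Set} → Dec P → ℤ
⟦ d ⟧ = if does d then + 1 else + 0

⟦⟧-yes : ∀ {P : Set} (d : Dec P) → P → ⟦ d ⟧ ≡ + 1
⟦⟧-yes d x = cong (if_then + 1 else + 0) (dec-true d x)

⟦⟧-no : ∀ {P : Set} (d : Dec P) → ¬ P → ⟦ d ⟧ ≡ + 0
⟦⟧-no d x = cong (if_then + 1 else + 0) (dec-false d x)

⟦⟧-⇔ : ∀ {P Q : Set} (d : Dec P) (e : Dec Q) → (P → Q) → (Q → P) → ⟦ d ⟧ ≡ ⟦ e ⟧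
⟦⟧-⇔ (yes x) e f g = sym (⟦⟧-yes e (f x))
⟦⟧-⇔ (no ¬x) e f g = sym (⟦⟧-no e (¬x ∘ g))

⟦⟧-× : ∀ {P Q R : Set} (d : Dec P) (e : Dec Q) (r : Dec R) → (P → Q × R) → (Q → R → P) → ⟦ d ⟧ ≡ ⟦ e ⟧ * ⟦ r ⟧
⟦⟧-× d (yes x) r f g = trans (⟦⟧-⇔ d r (proj₂ ∘ f) (g x)) (sym (ℤ.*-identityˡ _))
⟦⟧-× d (no ¬x) r f g = ⟦⟧-no d (¬x ∘ proj₁ ∘ f)

∑-filter : ∀ {P : A → Set} (P? : ∀ x → Dec (P x)) xs f →
           ∑ (List.filter P? xs) f ≡ ∑[ x ∈ xs ] ⟦ P? x ⟧ * f x
∑-filter P? []       f = refl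
∑-filter P? (x ∷ xs) f with P? x
... | true  because _ = cong₂ _+_ (sym (ℤ.*-identityˡ (f x))) (∑-filter P? xs f)
... | false because _ = trans (∑-filter P? xs f) (sym (ℤ.+-identityˡ _))

-- Σ_j α_j ∏_{i ≠ j} β_i
mixed : Vector ℤ k → Vector ℤ k → ℤ
mixed {zero}  α β = + 0
mixed {suc k} α β = α zero * prod (β ∘ suc) + β zero * mixed (α ∘ suc) (β ∘ suc)

dot : Vector ℤ k → Vec (Fin n) k → ℤ
dot ℓ ξ = sumℤ (λ j → ℓ j * + toℕ (lookup ξ j))

tailSystem : LinearSystem 2 (suc k) → LinearSystem 2 k
tailSystem L i j = L i (suc j)

minor : LinearSystem 2 k → Fin k → Fin k → ℤ
minor L i j = L 0F i * L 1F j - L 1F i * L 0F j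

δ : Fin n → ℤ
δ zero    = + 1
δ (suc _) = + 0

∑-const : ∀ (xs : List A) c → ∑[ _ ∈ xs ] c ≡ + List.length xs * c
∑-const []       c = refl
∑-const (x ∷ xs) c = trans (cong (_+_ c) (∑-const xs c)) (sym (ℤ.suc-* (+ List.length xs) c))

∑-allFin-const : ∀ n c → ∑[ _ ∈ List.allFin n ] c ≡ + n * c
∑-allFin-const n c = trans (∑-const (List.allFin n) c) (cong (λ l → + l * c) {List.length (List.allFin n)} {n} (length-tabulate id))

∑-affine-δ : ∀ n .{{_ : ℕ.NonZero n}} a b (φ : ℤ → ℤ) →
  ∑[ c ∈ List.allFin n ] (a + b * δ c) * φ (+ toℕ c) ≡ a * (∑[ c ∈ List.allFin n ] φ (+ toℕ c)) + b * φ (+ 0)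
∑-affine-δ n@(suc _) a b φ = begin
  (∑[ c ∈ List.allFin n ] (a + b * δ c) * φ (+ toℕ c))
    ≡⟨ ∑-cong (List.allFin n) (λ c → ring (δ c) (φ (+ toℕ c)) a b) ⟩
  (∑[ c ∈ List.allFin n ] a * φ (+ toℕ c) + b * (δ c * φ (+ toℕ c)))
    ≡⟨ ∑-+ (List.allFin n) (λ c → a * φ (+ toℕ c)) (λ c → b * (δ c * φ (+ toℕ c))) ⟩
  (∑[ c ∈ List.allFin n ] a * φ (+ toℕ c)) + (∑[ c ∈ List.allFin n ] b * (δ c * φ (+ toℕ c)))
    ≡⟨ cong₂ _+_ (∑-*ˡ (List.allFin n) a _)
         (trans (∑-*ˡ (List.allFin n) b _) (cong (_*_ b) (trans (∑-tabulate-point id _ zero δ≡0) (ℤ.*-identityˡ _)))) ⟩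
  a * (∑[ c ∈ List.allFin n ] φ (+ toℕ c)) + b * φ (+ 0) ∎
  where
  ring : ∀ d x a b → (a + b * d) * x ≡ a * x + b * (d * x)
  ring = solve-∀
  δ≡0 : ∀ (c : Fin n) → c ≢ zero → δ c * φ (+ toℕ c) ≡ + 0
  δ≡0 zero    c≢0 = ⊥-elim (c≢0 refl)
  δ≡0 (suc c) _   = refl

-- Products with one exceptional factor.

prod-const : ∀ n x → prod {n} (λ _ → x) ≡ x ℤ.^ n
prod-const zero    x = refl
prod-const (suc n) x = cong (_*_ x) (prod-const n x)

prod-*ˡ : ∀ q (β : Vector ℤ k) → prod (λ j → q * β j) ≡ q ℤ.^ k * prod β
prod-*ˡ {zero}  q β = refl
prod-*ˡ {suc k} q β = trans (cong (_*_ (q * β zero)) (prod-*ˡ q (β ∘ suc))) (ring q (β zero) (q ℤ.^ k) (prod (β ∘ suc)))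
  where
  ring : ∀ q b Q B → q * b * (Q * B) ≡ q * Q * (b * B)
  ring = solve-∀

mixed-cong : ∀ {α α′ β β′ : Vector ℤ k} → (∀ j → α j ≡ α′ j) → (∀ j → β j ≡ β′ j) → mixed α β ≡ mixed α′ β′
mixed-cong {zero}  α≗α′ β≗β′ = refl
mixed-cong {suc k} α≗α′ β≗β′ = cong₂ _+_
  (cong₂ _*_ (α≗α′ zero) (prod-cong (β≗β′ ∘ suc))) (cong₂ _*_ (β≗β′ zero) (mixed-cong (α≗α′ ∘ suc) (β≗β′ ∘ suc)))

-- Each term of `mixed` has only k - 1 factors from its second argument; the additional `q` on the
-- left completes the k-th power and avoids the exponent k - 1.
mixed-*ˡ : ∀ q (α β : Vector ℤ k) → q * mixed α (λ j → q * β j) ≡ q ℤ.^ k * mixed α β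
mixed-*ˡ {zero}  q α β = ℤ.*-zeroʳ q
mixed-*ˡ {suc k} q α β = begin
  q * (α zero * prod (λ j → q * β (suc j)) + q * β zero * mixed (α ∘ suc) (λ j → q * β (suc j)))
    ≡⟨ ring₁ q (α zero) (prod (λ j → q * β (suc j))) (β zero) (mixed (α ∘ suc) (λ j → q * β (suc j))) ⟩
  q * (α zero * prod (λ j → q * β (suc j))) + q * β zero * (q * mixed (α ∘ suc) (λ j → q * β (suc j)))
    ≡⟨ cong₂ (λ x y → q * (α zero * x) + q * β zero * y) (prod-*ˡ q (β ∘ suc)) (mixed-*ˡ q (α ∘ suc) (β ∘ suc)) ⟩
  q * (α zero * (q ℤ.^ k * prod (β ∘ suc))) + q * β zero * (q ℤ.^ k * mixed (α ∘ suc) (β ∘ suc))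
    ≡⟨ ring₂ q (α zero) (q ℤ.^ k) (prod (β ∘ suc)) (β zero) (mixed (α ∘ suc) (β ∘ suc)) ⟩
  q * q ℤ.^ k * mixed α β ∎
  where
  ring₁ : ∀ q a B b M → q * (a * B + q * b * M) ≡ q * (a * B) + q * b * (q * M)
  ring₁ = solve-∀
  ring₂ : ∀ q a Q B b M → q * (a * (Q * B)) + q * b * (Q * M) ≡ q * Q * (a * B + b * M)
  ring₂ = solve-∀

-- Replacing α_j by β_j in the j-th term completes it to the full product of β, and there are k
-- terms.
mixed-sub-diagonal : ∀ (α β : Vector ℤ k) → mixed (λ j → α j - β j) β ≡ mixed α β - + k * prod β
mixed-sub-diagonal {zero}  α β = refl
mixed-sub-diagonal {suc k} α β = trans
  (cong (λ m → (α zero - β zero) * prod (β ∘ suc) + β zero * m) (mixed-sub-diagonal (α ∘ suc) (β ∘ suc)))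
  (ring (α zero) (β zero) (prod (β ∘ suc)) (mixed (α ∘ suc) (β ∘ suc)) (+ k))
  where
  ring : ∀ a b B M k → (a - b) * B + b * (M - k * B) ≡ a * B + b * M - (+ 1 + k) * (b * B)
  ring = solve-∀

mixed-const : ∀ n x y → mixed {suc n} (λ _ → x) (λ _ → y) ≡ + suc n * (x * y ℤ.^ n)
mixed-const zero    x y = ring x y
  where
  ring : ∀ x y → x * + 1 + y * + 0 ≡ + 1 * (x * + 1)
  ring = solve-∀
mixed-const (suc n) x y = trans
  (cong₂ (λ a b → x * a + y * b) (prod-const (suc n) y) (mixed-const n x y))
  (ring x y (y ℤ.^ n) (+ suc n))
  where
  ring : ∀ x y Y n → x * (y * Y) + y * (n * (x * Y)) ≡ (+ 1 + n) * (x * (y * Y))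
  ring = solve-∀

-- Each term becomes the product of a single modified vector, so that a formula for sums of products
-- also applies to sums of `mixed`.
mixed-swap : ∀ (α β : Vector ℤ k) → mixed α β ≡ sumℤ (λ j → prod (updateAt β j (λ _ → α j)))
mixed-swap {zero}  α β = refl
mixed-swap {suc k} α β = cong (_+_ (α zero * prod (β ∘ suc)))
  (trans (cong (_*_ (β zero)) (mixed-swap (α ∘ suc) (β ∘ suc)))
         (*-distribˡ-sum (β zero) (λ j → prod (updateAt (β ∘ suc) j (λ _ → α (suc j))))))

-- Expand `mixed` of the linear forms A_j + B_j w_j and A′_j + B′_j w_j as a polynomial in the w_j:
-- this is the sum of the coefficients of the monomials that omit exactly one w_j.
mixed₂ : (A B A′ B′ : Vector ℤ k) → ℤ
mixed₂ A B A′ B′ = sumℤ (λ j → mixed (updateAt A′ j (λ _ → A j)) (updateAt B′ j (λ _ → B j)))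

sumℤ-const : ∀ n x → sumℤ {n} (λ _ → x) ≡ + n * x
sumℤ-const zero    x = refl
sumℤ-const (suc n) x = trans (cong (_+_ x) (sumℤ-const n x)) (sym (ℤ.suc-* (+ n) x))

mixed-zero : ∀ (α : Vector ℤ (suc (suc k))) → mixed α (λ _ → + 0) ≡ + 0
mixed-zero α = cong (_+ + 0) (ℤ.*-zeroʳ (α zero))

-- With at least three entries every term keeps two or more factors of the second vector, and at
-- most one of them is nonzero.
mixed-single : ∀ (α : Vector ℤ (suc (suc (suc k)))) j x → mixed α (updateAt (λ _ → + 0) j (λ _ → x)) ≡ + 0
mixed-single {k} α zero x = begin
  α zero * + 0 + x * mixed {suc (suc k)} (α ∘ suc) (λ _ → + 0)  ≡⟨ cong₂ (λ a m → a + x * m) (ℤ.*-zeroʳ (α zero)) (mixed-zero (α ∘ suc)) ⟩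
  + 0 + x * + 0                                                 ≡⟨ cong (_+_ (+ 0)) (ℤ.*-zeroʳ x) ⟩
  + 0                                                           ∎
mixed-single α (suc j) x = cong (_+ + 0) (trans (cong (_*_ (α zero)) (prod-single j)) (ℤ.*-zeroʳ (α zero)))
  where
  prod-single : ∀ {k} (j : Fin (suc (suc k))) → prod (updateAt (λ _ → + 0) j (λ _ → x)) ≡ + 0
  prod-single zero    = ℤ.*-zeroʳ x
  prod-single (suc j) = refl

-- The first summand is the term whose exceptional index is `j`; in all other terms `b` is an
-- ordinary factor and can be pulled out.
mixed-update-const : ∀ n (j : Fin (suc n)) x y a b →
  mixed (updateAt (λ _ → x) j (λ _ → a)) (updateAt (λ _ → y) j (λ _ → b)) ≡ a * y ℤ.^ n + b * mixed {n} (λ _ → x) (λ _ → y)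
mixed-update-const n       zero    x y a b = cong (λ z → a * z + b * mixed {n} (λ _ → x) (λ _ → y)) (prod-const n y)
mixed-update-const (suc n) (suc j) x y a b = begin
  x * prod (updateAt (λ _ → y) j (λ _ → b)) + y * mixed (updateAt (λ _ → x) j (λ _ → a)) (updateAt (λ _ → y) j (λ _ → b))
    ≡⟨ cong₂ (λ P M → x * P + y * M) (prod-update j) (mixed-update-const n j x y a b) ⟩
  x * (b * y ℤ.^ n) + y * (a * y ℤ.^ n + b * M)
    ≡⟨ ring x y a b (y ℤ.^ n) M ⟩
  a * (y * y ℤ.^ n) + b * (x * y ℤ.^ n + y * M)
    ≡⟨ cong (λ P → a * (y * y ℤ.^ n) + b * (x * P + y * M)) (prod-const n y) ⟨
  a * (y * y ℤ.^ n) + b * (x * prod {n} (λ _ → y) + y * M) ∎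
  where
  M = mixed {n} (λ _ → x) (λ _ → y)
  ring : ∀ x y a b Y M → x * (b * Y) + y * (a * Y + b * M) ≡ a * (y * Y) + b * (x * Y + y * M)
  ring = solve-∀
  prod-update : ∀ {n} (j : Fin (suc n)) → prod (updateAt (λ _ → y) j (λ _ → b)) ≡ b * y ℤ.^ n
  prod-update {n}     zero    = cong (_*_ b) (prod-const n y)
  prod-update {suc n} (suc j) = trans (cong (_*_ y) (prod-update j)) (ring′ y b (y ℤ.^ n))
    where
    ring′ : ∀ y b Y → y * (b * Y) ≡ b * (y * Y)
    ring′ = solve-∀

updateAt-zip : ∀ (A B A′ B′ w : Vector ℤ k) j i →
  updateAt (λ i → A′ i + B′ i * w i) j (λ _ → A j + B j * w j) i ≡
  updateAt A′ j (λ _ → A j) i + updateAt B′ j (λ _ → B j) i * w i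
updateAt-zip A B A′ B′ w zero    zero    = refl
updateAt-zip A B A′ B′ w zero    (suc i) = refl
updateAt-zip A B A′ B′ w (suc j) zero    = refl
updateAt-zip A B A′ B′ w (suc j) (suc i) = updateAt-zip (A ∘ suc) (B ∘ suc) (A′ ∘ suc) (B′ ∘ suc) (w ∘ suc) j i

^-distribʳ-* : ∀ x y n → (x * y) ℤ.^ n ≡ x ℤ.^ n * y ℤ.^ n
^-distribʳ-* x y n = begin
  (x * y) ℤ.^ n                  ≡⟨ prod-const n (x * y) ⟨
  prod {n} (λ _ → x * y)         ≡⟨ prod-*ˡ {n} x (λ _ → y) ⟩
  x ℤ.^ n * prod {n} (λ _ → y)   ≡⟨ cong (_*_ (x ℤ.^ n)) (prod-const n y) ⟩
  x ℤ.^ n * y ℤ.^ n              ∎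

pos-^ : ∀ m n → + (m ℕ.^ n) ≡ (+ m) ℤ.^ n
pos-^ m zero    = refl
pos-^ m (suc n) = trans (ℤ.pos-* m (m ℕ.^ n)) (cong (_*_ (+ m)) (pos-^ m n))

-- Integers inside the rationals, and clearing denominators.

fromℤ-homo-+ : ∀ a b → fromℤ (a + b) ≡ fromℤ a ℚ.+ fromℤ b
fromℤ-homo-+ a b = ℚ.toℚᵘ-injective (ℚᵘ.≃-trans (ℚ.toℚᵘ-fromℚᵘ (mkℚᵘ (a + b) 0)) (ℚᵘ.≃-trans
  (ℚᵘ.*≡* (ring a b))
  (ℚᵘ.≃-sym (ℚᵘ.≃-trans (ℚ.toℚᵘ-homo-+ (fromℤ a) (fromℤ b)) (ℚᵘ.+-cong (ℚ.toℚᵘ-fromℚᵘ (mkℚᵘ a 0)) (ℚ.toℚᵘ-fromℚᵘ (mkℚᵘ b 0)))))))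
  where
  ring : ∀ a b → (a + b) * + 1 ≡ (a * + 1 + b * + 1) * + 1
  ring = solve-∀

fromℤ-homo-* : ∀ a b → fromℤ (a * b) ≡ fromℤ a ℚ.* fromℤ b
fromℤ-homo-* a b = ℚ.toℚᵘ-injective (ℚᵘ.≃-trans (ℚ.toℚᵘ-fromℚᵘ (mkℚᵘ (a * b) 0))
  (ℚᵘ.≃-sym (ℚᵘ.≃-trans (ℚ.toℚᵘ-homo-* (fromℤ a) (fromℤ b)) (ℚᵘ.*-cong (ℚ.toℚᵘ-fromℚᵘ (mkℚᵘ a 0)) (ℚ.toℚᵘ-fromℚᵘ (mkℚᵘ b 0))))))

fromℤ-homo-neg : ∀ a → fromℤ (- a) ≡ ℚ.- fromℤ a
fromℤ-homo-neg a = ℚ.toℚᵘ-injective (ℚᵘ.≃-trans (ℚ.toℚᵘ-fromℚᵘ (mkℚᵘ (- a) 0))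
  (ℚᵘ.≃-sym (ℚᵘ.≃-trans (ℚ.toℚᵘ-homo‿- (fromℤ a)) (ℚᵘ.-‿cong (ℚ.toℚᵘ-fromℚᵘ (mkℚᵘ a 0))))))

fromℤ-homo-- : ∀ a b → fromℤ (a - b) ≡ fromℤ a ℚ.- fromℤ b
fromℤ-homo-- a b = trans (fromℤ-homo-+ a (- b)) (cong (ℚ._+_ (fromℤ a)) (fromℤ-homo-neg b))

fromℤ-mono-≤ : ∀ {a b} → a ℤ.≤ b → fromℤ a ℚ.≤ fromℤ b
fromℤ-mono-≤ {a} {b} a≤b = ℚ.toℚᵘ-cancel-≤ (ℚᵘ.≤-respˡ-≃ (ℚᵘ.≃-sym (ℚ.toℚᵘ-fromℚᵘ (mkℚᵘ a 0))) (ℚᵘ.≤-respʳ-≃ (ℚᵘ.≃-sym (ℚ.toℚᵘ-fromℚᵘ (mkℚᵘ b 0)))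
  (ℚᵘ.*≤* (ℤ.*-monoʳ-≤-nonNeg (+ 1) a≤b))))

fromℤ-cancel-≤ : ∀ {a b} → fromℤ a ℚ.≤ fromℤ b → a ℤ.≤ b
fromℤ-cancel-≤ {a} {b} a≤b with ℚᵘ.≤-respˡ-≃ (ℚ.toℚᵘ-fromℚᵘ (mkℚᵘ a 0)) (ℚᵘ.≤-respʳ-≃ (ℚ.toℚᵘ-fromℚᵘ (mkℚᵘ b 0)) (ℚ.toℚᵘ-mono-≤ a≤b))
... | ℚᵘ.*≤* le = ℤ.*-cancelʳ-≤-pos a b (+ 1) le

fromℤ-injective : ∀ {a b} → fromℤ a ≡ fromℤ b → a ≡ b
fromℤ-injective eq = ℤ.≤-antisym (fromℤ-cancel-≤ (ℚ.≤-reflexive eq)) (fromℤ-cancel-≤ (ℚ.≤-reflexive (sym eq)))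

fromℤ-*-/ : ∀ z n .{{_ : ℕ.NonZero n}} → fromℤ (+ n) ℚ.* (z ℚ./ n) ≡ fromℤ z
fromℤ-*-/ z n@(suc n-1) = ℚ.toℚᵘ-injective (ℚᵘ.≃-trans (ℚ.toℚᵘ-homo-* (fromℤ (+ n)) (z ℚ./ n))
  (ℚᵘ.≃-trans (ℚᵘ.*-cong (ℚ.toℚᵘ-fromℚᵘ (mkℚᵘ (+ n) 0)) (ℚ.toℚᵘ-fromℚᵘ (mkℚᵘ z n-1)))
    (ℚᵘ.≃-trans (ℚᵘ.*≡* (ring (+ n) z)) (ℚᵘ.≃-sym (ℚ.toℚᵘ-fromℚᵘ (mkℚᵘ z 0))))))
  where
  ring : ∀ n z → n * z * + 1 ≡ z * (+ 1 * n)
  ring = solve-∀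

-- Everything is evaluated at one index `i` of the Cauchy sequences, where `c` is a common
-- denominator of the values of `f` and `z` gives their numerators.
module _ {A : Set} {c : ℤ} (f : A → ℝ) (z : A → ℤ) (i : ℕ)
         (scaled : ∀ a → fromℤ c ℚ.* seq (f a) i ≡ fromℤ (z a)) where

  seq-product : ∀ (x : Vec A n) →
    fromℤ (c ℤ.^ n) ℚ.* seq (productᴿ (Vec.toList (Vec.map f x))) i ≡ fromℤ (prod (λ j → z (lookup x j)))
  seq-product []      = refl
  seq-product {suc n} (a ∷ x) = begin
    fromℤ (c * c ℤ.^ n) ℚ.* (y ℚ.* Y)
      ≡⟨ cong (ℚ._* (y ℚ.* Y)) (fromℤ-homo-* c (c ℤ.^ n)) ⟩
    fromℤ c ℚ.* fromℤ (c ℤ.^ n) ℚ.* (y ℚ.* Y)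
      ≡⟨ ring (fromℤ c) (fromℤ (c ℤ.^ n)) y Y ⟩
    (fromℤ c ℚ.* y) ℚ.* (fromℤ (c ℤ.^ n) ℚ.* Y)
      ≡⟨ cong₂ ℚ._*_ (scaled a) (seq-product x) ⟩
    fromℤ (z a) ℚ.* fromℤ (prod (λ j → z (lookup x j)))
      ≡⟨ fromℤ-homo-* (z a) _ ⟨
    fromℤ (z a * prod (λ j → z (lookup x j))) ∎
    where
    y = seq (f a) i
    Y = seq (productᴿ (Vec.toList (Vec.map f x))) i
    open +-*-Solver
    ring : ∀ a b c d → a ℚ.* b ℚ.* (c ℚ.* d) ≡ (a ℚ.* c) ℚ.* (b ℚ.* d)
    ring = solve 4 (λ a b c d → a :* b :* (c :* d) := (a :* c) :* (b :* d)) refl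

  seq-sum : ∀ (xs : List A) → fromℤ c ℚ.* seq (sumᴿ (List.map f xs)) i ≡ fromℤ (∑ xs z)
  seq-sum []       = ℚ.*-zeroʳ (fromℤ c)
  seq-sum (x ∷ xs) = trans (ℚ.*-distribˡ-+ (fromℤ c) _ _)
    (trans (cong₂ ℚ._+_ (scaled x) (seq-sum xs)) (sym (fromℤ-homo-+ (z x) (∑ xs z))))

-- Multiplying by the length instead of dividing makes the dummy value on the empty list harmless.
seq-average : ∀ (l : List ℝ) i → fromℤ (+ List.length l) ℚ.* seq (average l) i ≡ seq (sumᴿ l) i
seq-average []       i = refl
seq-average (x ∷ xs) i = trans (sym (ℚ.*-assoc (fromℤ (+ l)) (+ 1 ℚ./ l) S))
  (trans (cong (ℚ._* S) (fromℤ-*-/ (+ 1) l)) (ℚ.*-identityˡ S))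
  where
  l = suc (List.length xs)
  S = seq (sumᴿ (x ∷ xs)) i

≤+ε⇒≤ : ∀ {x y} → (∀ ε → 0ℚ ℚ.< ε → x ℚ.≤ y ℚ.+ ε) → x ℚ.≤ y
≤+ε⇒≤ {x} {y} h = ℚ.≮⇒≥ λ y<x →
  let m , y<m , m<x = ℚ.<-dense y<x
      0<m-y = subst (ℚ._< m ℚ.- y) (ℚ.+-inverseʳ y) (ℚ.+-monoˡ-< (ℚ.- y) y<m)
  in ℚ.<-irrefl refl (ℚ.<-≤-trans m<x (subst (x ℚ.≤_) (ring y m) (h (m ℚ.- y) 0<m-y)))
  where
  open +-*-Solver
  ring : ∀ y m → y ℚ.+ (m ℚ.- y) ≡ m
  ring = solve 2 (λ y m → y :+ (m :- y) := m) refl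

∣i∣≤n⇒0≤n+i : ∀ {n} i → ℤ.∣ i ∣ ℕ.≤ n → + 0 ℤ.≤ + n + i
∣i∣≤n⇒0≤n+i     (+ m)      _   = ℤ.+≤+ ℕ.z≤n
∣i∣≤n⇒0≤n+i {n} ℤ.-[1+ m ] m<n = subst (+ 0 ℤ.≤_) (sym (ℤ.⊖-≥ m<n)) (ℤ.+≤+ ℕ.z≤n)

∣i∣≤n⇒0≤n-i : ∀ {n} i → ℤ.∣ i ∣ ℕ.≤ n → + 0 ℤ.≤ + n - i
∣i∣≤n⇒0≤n-i {n} i i≤n = ∣i∣≤n⇒0≤n+i (- i) (subst (ℕ._≤ n) (sym (ℤ.∣-i∣≡∣i∣ i)) i≤n)

-- Minors, girth, and positivity of integers.

fin-bound : ∀ n (h : Fin n → ℕ) → ∃[ B ] (∀ i → h i ℕ.≤ B)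
fin-bound zero    h = 0 , λ ()
fin-bound (suc n) h = h zero ℕ.⊔ proj₁ rest , λ
  { zero    → ℕ.m≤m⊔n (h zero) (proj₁ rest)
  ; (suc i) → ℕ.≤-trans (proj₂ rest i) (ℕ.m≤n⊔m (h zero) (proj₁ rest)) }
  where
  rest = fin-bound n (h ∘ suc)

minors-bounded : ∀ (L : LinearSystem 2 k) → ∃[ B ] (∀ i j → ℤ.∣ minor L i j ∣ ℕ.≤ B)
minors-bounded {k} L = proj₁ bound , λ i j → ℕ.≤-trans (proj₂ (row i) j) (proj₂ bound i)
  where
  row : ∀ i → ∃[ B ] (∀ j → ℤ.∣ minor L i j ∣ ℕ.≤ B)
  row i = fin-bound k (λ j → ℤ.∣ minor L i j ∣)
  bound = fin-bound k (λ i → proj₁ (row i))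

∣∣-missing-two : ∀ (s : Subset k) {i j} → i ≢ j → i ∉ s → j ∉ s → ∣ s ∣ ℕ.< k ∸ 1
∣∣-missing-two {k} s {i} {j} i≢j i∉s j∉s = ℕ.≤-trans
  (ℕ.s≤s (p⊆q⇒∣p∣≤∣q∣ s⊆))
  (ℕ.≤-trans (x∈p⇒∣p-x∣<∣p∣ (x∈p∧x≢y⇒x∈p-y ∈⊤ (i≢j ∘ sym)))
    (ℕ.∸-monoˡ-≤ 1 (subst (suc ∣ ⊤ ∖ i ∣ ℕ.≤_) (∣⊤∣≡n k) (x∈p⇒∣p-x∣<∣p∣ {x = i} ∈⊤))))
  where
  s⊆ : ∀ {x} → x ∈ s → x ∈ (⊤ ∖ i) ∖ j
  s⊆ x∈s = x∈p∧x≢y⇒x∈p-y (x∈p∧x≢y⇒x∈p-y ∈⊤ λ { refl → i∉s x∈s }) λ { refl → j∉s x∈s }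

zero∉support : ∀ (v : Vector ℚ k) {i} → v i ≡ 0ℚ → i ∉ support v
zero∉support v {i} vi≡0 i∈ with trans (sym (lookup∘tabulate (λ j → does (¬? (v j ℚ.≟ 0ℚ))) i)) ([]=⇒lookup i∈)
... | eq with trans (sym eq) (dec-false (¬? (v i ℚ.≟ 0ℚ)) (λ vi≢0 → vi≢0 vi≡0))
... | ()

-- The combination of the two rows that cancels column `i` takes at `j` the value minus the minor.
-- If that is zero, the support has at most k - 2 elements, contradicting the girth. The combination
-- is nonzero: by independence of the rows it could vanish only if its coefficients, the entries of
-- column `i` up to sign, were zero.
girth⇒minor≢0 : ∀ (L : LinearSystem 2 k) → Irredundant L → HasGirth L (k ∸ 1) → ∀ i j → i ≢ j → minor L i j ≢ + 0
girth⇒minor≢0 {k} L irr (_ , girth) i j i≢j minor≡0 =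
  ℕ.<⇒≱ (∣∣-missing-two (support v) i≢j (zero∉support v v-i) (zero∉support v v-j)) (girth v ((c , λ _ → refl) , v≢0))
  where
  open Irredundant irr
  c : Vector ℚ 2
  c 0F = fromℤ (L 1F i)
  c 1F = fromℤ (- L 0F i)
  v : Vector ℚ k
  v = rowCombination L c
  v-eq : ∀ l → v l ≡ fromℤ (- minor L i l)
  v-eq l = begin
    fromℤ (L 1F i) ℚ.* fromℤ (L 0F l) ℚ.+ (fromℤ (- L 0F i) ℚ.* fromℤ (L 1F l) ℚ.+ 0ℚ)
      ≡⟨ cong₂ ℚ._+_ (sym (fromℤ-homo-* (L 1F i) (L 0F l))) (trans (ℚ.+-identityʳ _) (sym (fromℤ-homo-* (- L 0F i) (L 1F l)))) ⟩
    fromℤ (L 1F i * L 0F l) ℚ.+ fromℤ (- L 0F i * L 1F l)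
      ≡⟨ fromℤ-homo-+ (L 1F i * L 0F l) (- L 0F i * L 1F l) ⟨
    fromℤ (L 1F i * L 0F l + - L 0F i * L 1F l)
      ≡⟨ cong fromℤ (ring (L 0F i) (L 1F i) (L 0F l) (L 1F l)) ⟩
    fromℤ (- minor L i l) ∎
    where
    ring : ∀ a b c d → b * c + - a * d ≡ - (a * d - b * c)
    ring = solve-∀
  v-i : v i ≡ 0ℚ
  v-i = trans (v-eq i) (cong fromℤ (ring (L 0F i) (L 1F i)))
    where
    ring : ∀ a b → - (a * b - b * a) ≡ + 0
    ring = solve-∀
  v-j : v j ≡ 0ℚ
  v-j = trans (v-eq j) (cong (λ m → fromℤ (- m)) minor≡0)
  v≢0 : ¬ (∀ l → v l ≡ 0ℚ)
  v≢0 v≡0 = columns-nonzero i λ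
    { 0F → trans (sym (ℤ.neg-involutive (L 0F i))) (cong -_ (fromℤ-injective {b = + 0} (c≡0 1F)))
    ; 1F → fromℤ-injective {b = + 0} (c≡0 0F) }
    where
    c≡0 = rows-independent c v≡0

0<* : ∀ {a b} → + 0 ℤ.< a → + 0 ℤ.< b → + 0 ℤ.< a * b
0<* {+ suc _} {+ suc _} _          _          = ℤ.+<+ (ℕ.s≤s ℕ.z≤n)
0<* {+ suc _} {+ zero}  _          (ℤ.+<+ ())
0<* {+ zero}            (ℤ.+<+ ()) _

0<^ : ∀ {a} n → + 0 ℤ.< a → + 0 ℤ.< a ℤ.^ n
0<^ zero    0<a = ℤ.+<+ (ℕ.s≤s ℕ.z≤n)
0<^ (suc n) 0<a = 0<* 0<a (0<^ n 0<a)

0<n²-1 : ∀ n → .{{ℕ.NonTrivial n}} → + 0 ℤ.< + n * + n - + 1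
0<n²-1 (suc (suc r)) = subst (+ 0 ℤ.<_) (ring (+ suc (suc r))) (0<* {+ suc r} {+ suc (suc (suc r))} (ℤ.+<+ (ℕ.s≤s ℕ.z≤n)) (ℤ.+<+ (ℕ.s≤s ℕ.z≤n)))
  where
  ring : ∀ q → (q - + 1) * (+ 1 + q) ≡ q * q - + 1
  ring = solve-∀

-- Congruences, and lines through the origin of 𝔽_p².

module Modular (p : ℕ) (p-prime : Prime p) where

  instance
    p≢0 : ℕ.NonZero p
    p≢0 = prime⇒nonZero p-prime

  χ : ℤ → ℤ
  χ z = ⟦ + p ∣ℤ? z ⟧

  euclid : ∀ m n → + p ∣ℤ m * n → ¬ + p ∣ℤ m → + p ∣ℤ n
  euclid m n p∣mn p∤m = [ ⊥-elim ∘ p∤m ∘ ∣ᵤ⇒∣ , ∣ᵤ⇒∣ ]′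
    (euclidsLemma ℤ.∣ m ∣ ℤ.∣ n ∣ p-prime (subst (p ℕ.∣_) (ℤ.abs-* m n) (∣⇒∣ᵤ p∣mn)))

  inverse⁺ : ∀ n → ¬ + p ∣ℤ + n → ∃[ m ] (+ p ∣ℤ + n * m - + 1)
  inverse⁺ n p∤n with coprime-Bézout coprime
    where
    coprime : Coprime p n
    coprime {d} (d∣p , d∣n) with prime⇒irreducible p-prime d∣p
    ... | inj₁ d≡1 = d≡1
    ... | inj₂ d≡p = ⊥-elim (p∤n (∣ᵤ⇒∣ (subst (ℕ._∣ n) d≡p d∣n)))
  ... | Bézout.+- x y eq = - + y , divides (- + x) (begin
      + n * - + y - + 1          ≡⟨ ring (+ n) (+ y) ⟩
      - (+ 1 + + y * + n)        ≡⟨ cong (λ z → - (+ 1 + z)) (ℤ.pos-* y n) ⟨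
      - + (1 ℕ.+ y ℕ.* n)        ≡⟨ cong (λ z → - + z) eq ⟩
      - + (x ℕ.* p)              ≡⟨ cong -_ (ℤ.pos-* x p) ⟩
      - (+ x * + p)              ≡⟨ ℤ.neg-distribˡ-* (+ x) (+ p) ⟩
      - + x * + p                ∎)
    where
    ring : ∀ n y → n * - y - + 1 ≡ - (+ 1 + y * n)
    ring = solve-∀
  ... | Bézout.-+ x y eq = + y , divides (+ x) (begin
      + n * + y - + 1            ≡⟨ cong (λ z → z - + 1) (trans (ℤ.*-comm (+ n) (+ y)) (sym (ℤ.pos-* y n))) ⟩
      + (y ℕ.* n) - + 1          ≡⟨ cong (λ z → + z - + 1) eq ⟨
      + 1 + + (x ℕ.* p) - + 1    ≡⟨ ring (+ (x ℕ.* p)) ⟩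
      + (x ℕ.* p)                ≡⟨ ℤ.pos-* x p ⟩
      + x * + p                  ∎)
    where
    ring : ∀ z → + 1 + z - + 1 ≡ z
    ring = solve-∀

  inverse : ∀ n → ¬ + p ∣ℤ n → ∃[ m ] (+ p ∣ℤ n * m - + 1)
  inverse (+ n)      p∤n = inverse⁺ n p∤n
  inverse ℤ.-[1+ n ] p∤n =
    let m , p∣ = inverse⁺ (suc n) (λ p∣n → p∤n (∣ᵤ⇒∣ (∣⇒∣ᵤ p∣n)))
    in - m , subst (+ p ∣ℤ_) (ring (+ suc n) m) p∣
    where
    ring : ∀ a m → a * m - + 1 ≡ - a * - m - + 1
    ring = solve-∀

  residue-unique : ∀ (c d : Fin p) → + p ∣ℤ + toℕ c - + toℕ d → c ≡ d
  residue-unique c d p∣c-d = Fin.toℕ-injective (ℤ.+-injective (ℤ.i-j≡0⇒i≡j _ _ (ℤ.∣i∣≡0⇒i≡0 (small _ below (∣⇒∣ᵤ p∣c-d)))))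
    where
    small : ∀ n → n ℕ.< p → p ℕ.∣ n → n ≡ 0
    small zero    _   _   = refl
    small (suc n) n<p p∣n = ⊥-elim (ℕ.<⇒≱ n<p (ℕ.∣⇒≤ p∣n))
    below : ℤ.∣ + toℕ c - + toℕ d ∣ ℕ.< p
    below = ℕ.≤-<-trans
      (subst (λ z → ℤ.∣ z ∣ ℕ.≤ toℕ c ℕ.⊔ toℕ d) (sym (ℤ.[+m]-[+n]≡m⊖n (toℕ c) (toℕ d))) (ℤ.∣m⊝n∣≤m⊔n (toℕ c) (toℕ d)))
      (ℕ.⊔-lub (Fin.toℕ<n c) (Fin.toℕ<n d))

  ∑-χ : ∀ z m → ¬ + p ∣ℤ m → ∑[ c ∈ List.allFin p ] χ (z + m * + toℕ c) ≡ + 1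
  ∑-χ z m p∤m = trans (∑-tabulate-point id _ c₀ others) (⟦⟧-yes (+ p ∣ℤ? _) p∣c₀)
    where
    m⁻¹ = proj₁ (inverse m p∤m)
    -- The residue of -z / m, the only root of the linear congruence.
    c₀ : Fin p
    c₀ = fromℕ< (n%ℕd<d (- z * m⁻¹) p)
    q = (- z * m⁻¹) /ℕ p
    c₀-eq : + toℕ c₀ ≡ - z * m⁻¹ - q * + p
    c₀-eq = begin
      + toℕ c₀                                       ≡⟨ cong +_ (Fin.toℕ-fromℕ< _) ⟩
      + ((- z * m⁻¹) %ℕ p)                           ≡⟨ ring (+ ((- z * m⁻¹) %ℕ p)) (q * + p) ⟩
      + ((- z * m⁻¹) %ℕ p) + q * + p - q * + p       ≡⟨ cong (λ w → w - q * + p) (a≡a%ℕn+[a/ℕn]*n (- z * m⁻¹) p) ⟨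
      - z * m⁻¹ - q * + p                            ∎
      where
      ring : ∀ a b → a ≡ a + b - b
      ring = solve-∀
    p∣c₀ : + p ∣ℤ z + m * + toℕ c₀
    p∣c₀ = subst (+ p ∣ℤ_) (trans (ring z m m⁻¹ q (+ p)) (cong (λ c → z + m * c) (sym c₀-eq)))
      (∣m∣n⇒∣m+n (∣n⇒∣m*n (- z) (proj₂ (inverse m p∤m))) (∣n⇒∣m*n (- (m * q)) (divides (+ 1) (sym (ℤ.*-identityˡ (+ p))))))
      where
      ring : ∀ z m m⁻¹ q p → - z * (m * m⁻¹ - + 1) + - (m * q) * p ≡ z + m * (- z * m⁻¹ - q * p)
      ring = solve-∀
    others : ∀ c → c ≢ c₀ → χ (z + m * + toℕ c) ≡ + 0
    others c c≢c₀ = ⟦⟧-no (+ p ∣ℤ? _) (λ p∣c → c≢c₀ (residue-unique c c₀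
      (euclid m _ (subst (+ p ∣ℤ_) (ring z m (+ toℕ c) (+ toℕ c₀)) (∣m∣n⇒∣m-n {+ p} {z + m * + toℕ c} {z + m * + toℕ c₀} p∣c p∣c₀)) p∤m)))
      where
      ring : ∀ z m c d → (z + m * c) - (z + m * d) ≡ m * (c - d)
      ring = solve-∀

  -- Both sides vanish unless `p` divides `a`, and then `b` and `d` are interchangeable. In `∑-χχ`
  -- this replaces a factor depending on the summation variable by a constant one.
  χ-absorb : ∀ a b d → (+ p ∣ℤ a → + p ∣ℤ b → + p ∣ℤ d) → (+ p ∣ℤ a → + p ∣ℤ d → + p ∣ℤ b) → χ a * χ b ≡ χ d * χ a
  χ-absorb a b d b⇒d d⇒b with + p ∣ℤ? a
  ... | yes p∣a = trans (cong₂ _*_ (⟦⟧-yes (+ p ∣ℤ? a) p∣a) (⟦⟧-⇔ (+ p ∣ℤ? b) (+ p ∣ℤ? d) (b⇒d p∣a) (d⇒b p∣a)))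
                  (trans (ℤ.*-comm (+ 1) (χ d)) (cong (_*_ (χ d)) (sym (⟦⟧-yes (+ p ∣ℤ? a) p∣a))))
  ... | no p∤a  = trans (cong (_* χ b) (⟦⟧-no (+ p ∣ℤ? a) p∤a))
                  (sym (trans (cong (_*_ (χ d)) (⟦⟧-no (+ p ∣ℤ? a) p∤a)) (ℤ.*-zeroʳ (χ d))))

  -- As ℓ is nonzero modulo `p`, the points v + cℓ are distinct, and one of them is the origin
  -- exactly when v is a multiple of ℓ, that is, when the determinant vanishes. The two cases solve
  -- for `c` in whichever equation has an invertible coefficient.
  ∑-χχ : ∀ v₀ v₁ ℓ₀ ℓ₁ → ¬ (+ p ∣ℤ ℓ₀ × + p ∣ℤ ℓ₁) →
         ∑[ c ∈ List.allFin p ] χ (v₀ + ℓ₀ * + toℕ c) * χ (v₁ + ℓ₁ * + toℕ c) ≡ χ (v₀ * ℓ₁ - v₁ * ℓ₀)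
  ∑-χχ v₀ v₁ ℓ₀ ℓ₁ ℓ≢0 with + p ∣ℤ? ℓ₀
  ... | no p∤ℓ₀ = begin
      (∑[ c ∈ List.allFin p ] χ (v₀ + ℓ₀ * + toℕ c) * χ (v₁ + ℓ₁ * + toℕ c))
        ≡⟨ ∑-cong (List.allFin p) (λ c → χ-absorb _ _ (v₀ * ℓ₁ - v₁ * ℓ₀)
             (λ p∣a p∣b → subst (+ p ∣ℤ_) (ring₁ v₀ v₁ ℓ₀ ℓ₁ (+ toℕ c)) (∣m∣n⇒∣m-n (∣n⇒∣m*n ℓ₁ p∣a) (∣n⇒∣m*n ℓ₀ p∣b)))
             (λ p∣a p∣d → euclid ℓ₀ _ (subst (+ p ∣ℤ_) (ring₂ v₀ v₁ ℓ₀ ℓ₁ (+ toℕ c)) (∣m∣n⇒∣m-n (∣n⇒∣m*n ℓ₁ p∣a) p∣d)) p∤ℓ₀)) ⟩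
      (∑[ c ∈ List.allFin p ] χ (v₀ * ℓ₁ - v₁ * ℓ₀) * χ (v₀ + ℓ₀ * + toℕ c))
        ≡⟨ ∑-*ˡ (List.allFin p) (χ (v₀ * ℓ₁ - v₁ * ℓ₀)) _ ⟩
      χ (v₀ * ℓ₁ - v₁ * ℓ₀) * (∑[ c ∈ List.allFin p ] χ (v₀ + ℓ₀ * + toℕ c))
        ≡⟨ cong (_*_ (χ (v₀ * ℓ₁ - v₁ * ℓ₀))) (∑-χ v₀ ℓ₀ p∤ℓ₀) ⟩
      χ (v₀ * ℓ₁ - v₁ * ℓ₀) * + 1
        ≡⟨ ℤ.*-identityʳ _ ⟩
      χ (v₀ * ℓ₁ - v₁ * ℓ₀) ∎
    where
    ring₁ : ∀ v₀ v₁ ℓ₀ ℓ₁ c → ℓ₁ * (v₀ + ℓ₀ * c) - ℓ₀ * (v₁ + ℓ₁ * c) ≡ v₀ * ℓ₁ - v₁ * ℓ₀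
    ring₁ = solve-∀
    ring₂ : ∀ v₀ v₁ ℓ₀ ℓ₁ c → ℓ₁ * (v₀ + ℓ₀ * c) - (v₀ * ℓ₁ - v₁ * ℓ₀) ≡ ℓ₀ * (v₁ + ℓ₁ * c)
    ring₂ = solve-∀
  ... | yes p∣ℓ₀ = begin
      (∑[ c ∈ List.allFin p ] χ (v₀ + ℓ₀ * + toℕ c) * χ (v₁ + ℓ₁ * + toℕ c))
        ≡⟨ ∑-cong (List.allFin p) (λ c → trans (ℤ.*-comm (χ (v₀ + ℓ₀ * + toℕ c)) _) (χ-absorb _ _ (v₀ * ℓ₁ - v₁ * ℓ₀)
             (λ p∣a p∣b → subst (+ p ∣ℤ_) (ring₁ v₀ v₁ ℓ₀ ℓ₁ (+ toℕ c)) (∣m∣n⇒∣m-n (∣n⇒∣m*n ℓ₁ p∣b) (∣n⇒∣m*n ℓ₀ p∣a)))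
             (λ p∣a p∣d → euclid ℓ₁ _ (subst (+ p ∣ℤ_) (ring₂ v₀ v₁ ℓ₀ ℓ₁ (+ toℕ c)) (∣m∣n⇒∣m+n (∣n⇒∣m*n ℓ₀ p∣a) p∣d)) p∤ℓ₁))) ⟩
      (∑[ c ∈ List.allFin p ] χ (v₀ * ℓ₁ - v₁ * ℓ₀) * χ (v₁ + ℓ₁ * + toℕ c))
        ≡⟨ ∑-*ˡ (List.allFin p) (χ (v₀ * ℓ₁ - v₁ * ℓ₀)) _ ⟩
      χ (v₀ * ℓ₁ - v₁ * ℓ₀) * (∑[ c ∈ List.allFin p ] χ (v₁ + ℓ₁ * + toℕ c))
        ≡⟨ cong (_*_ (χ (v₀ * ℓ₁ - v₁ * ℓ₀))) (∑-χ v₁ ℓ₁ p∤ℓ₁) ⟩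
      χ (v₀ * ℓ₁ - v₁ * ℓ₀) * + 1
        ≡⟨ ℤ.*-identityʳ _ ⟩
      χ (v₀ * ℓ₁ - v₁ * ℓ₀) ∎
    where
    p∤ℓ₁ : ¬ + p ∣ℤ ℓ₁
    p∤ℓ₁ p∣ℓ₁ = ℓ≢0 (p∣ℓ₀ , p∣ℓ₁)
    ring₁ : ∀ v₀ v₁ ℓ₀ ℓ₁ c → ℓ₁ * (v₀ + ℓ₀ * c) - ℓ₀ * (v₁ + ℓ₁ * c) ≡ v₀ * ℓ₁ - v₁ * ℓ₀
    ring₁ = solve-∀
    ring₂ : ∀ v₀ v₁ ℓ₀ ℓ₁ c → ℓ₀ * (v₁ + ℓ₁ * c) + (v₀ * ℓ₁ - v₁ * ℓ₀) ≡ ℓ₁ * (v₀ + ℓ₀ * c)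
    ring₂ = solve-∀

  -- This is `mixed a b` with the j-th term multiplied by the indicator that v lies on the line
  -- spanned by column j, expressed by a determinant.
  lines : LinearSystem 2 k → Vector ℤ k → Vector ℤ k → ℤ → ℤ → ℤ
  lines {zero}  L a b v₀ v₁ = + 0
  lines {suc k} L a b v₀ v₁ =
    a zero * prod (b ∘ suc) * χ (v₀ * L 1F zero - v₁ * L 0F zero) + b zero * lines (tailSystem L) (a ∘ suc) (b ∘ suc) v₀ v₁

  -- An affine line in direction ℓ meets every line spanned by a column exactly once, because ℓ is
  -- parallel to no column; each indicator therefore contributes 1.
  ∑-lines : ∀ (L : LinearSystem 2 k) a b v₀ v₁ ℓ₀ ℓ₁ → (∀ j → ¬ + p ∣ℤ ℓ₀ * L 1F j - ℓ₁ * L 0F j) →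
            ∑[ c ∈ List.allFin p ] lines L a b (v₀ + ℓ₀ * + toℕ c) (v₁ + ℓ₁ * + toℕ c) ≡ mixed a b
  ∑-lines {zero}  L a b v₀ v₁ ℓ₀ ℓ₁ p∤ = ∑-zero (List.allFin p)
  ∑-lines {suc k} L a b v₀ v₁ ℓ₀ ℓ₁ p∤ = begin
    (∑[ c ∈ List.allFin p ] m₀ * χ (V₀ c * L 1F zero - V₁ c * L 0F zero) + b zero * lines L′ a′ b′ (V₀ c) (V₁ c))
      ≡⟨ ∑-+ (List.allFin p) _ _ ⟩
    (∑[ c ∈ List.allFin p ] m₀ * χ (V₀ c * L 1F zero - V₁ c * L 0F zero)) + (∑[ c ∈ List.allFin p ] b zero * lines L′ a′ b′ (V₀ c) (V₁ c))
      ≡⟨ cong₂ _+_ (∑-*ˡ (List.allFin p) m₀ _) (∑-*ˡ (List.allFin p) (b zero) _) ⟩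
    m₀ * (∑[ c ∈ List.allFin p ] χ (V₀ c * L 1F zero - V₁ c * L 0F zero)) + b zero * (∑[ c ∈ List.allFin p ] lines L′ a′ b′ (V₀ c) (V₁ c))
      ≡⟨ cong₂ _+_ (cong (_*_ m₀) one) (cong (_*_ (b zero)) (∑-lines L′ a′ b′ v₀ v₁ ℓ₀ ℓ₁ (p∤ ∘ suc))) ⟩
    m₀ * + 1 + b zero * mixed a′ b′
      ≡⟨ cong (λ z → z + b zero * mixed a′ b′) (ℤ.*-identityʳ m₀) ⟩
    m₀ + b zero * mixed a′ b′ ∎
    where
    L′ = tailSystem L
    a′ = a ∘ suc
    b′ = b ∘ suc
    m₀ = a zero * prod b′
    V₀ V₁ : Fin p → ℤ
    V₀ c = v₀ + ℓ₀ * + toℕ c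
    V₁ c = v₁ + ℓ₁ * + toℕ c
    ring : ∀ v₀ v₁ ℓ₀ ℓ₁ c m₀ m₁ → (v₀ + ℓ₀ * c) * m₁ - (v₁ + ℓ₁ * c) * m₀ ≡ (v₀ * m₁ - v₁ * m₀) + (ℓ₀ * m₁ - ℓ₁ * m₀) * c
    ring = solve-∀
    one : ∑[ c ∈ List.allFin p ] χ (V₀ c * L 1F zero - V₁ c * L 0F zero) ≡ + 1
    one = trans (∑-cong (List.allFin p) (λ c → cong χ (ring v₀ v₁ ℓ₀ ℓ₁ (+ toℕ c) (L 0F zero) (L 1F zero))))
                (∑-χ (v₀ * L 1F zero - v₁ * L 0F zero) (ℓ₀ * L 1F zero - ℓ₁ * L 0F zero) (p∤ zero))

  -- Weighted sums over the solutions in 𝔽_p.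

  record GeneralPosition (L : LinearSystem 2 k) : Set where
    constructor generalPosition
    field
      -- For two or more columns this follows from the minors, but the induction over columns
      -- descends to a single one.
      column≢0 : ∀ j → ¬ (+ p ∣ℤ L 0F j × + p ∣ℤ L 1F j)
      minor≢0  : ∀ i j → i ≢ j → ¬ + p ∣ℤ minor L i j

  open GeneralPosition

  generalPosition-tail : {L : LinearSystem 2 (suc k)} → GeneralPosition L → GeneralPosition (tailSystem L)
  generalPosition-tail gp = generalPosition (λ j → column≢0 gp (suc j)) (λ i j i≢j → minor≢0 gp (suc i) (suc j) (i≢j ∘ Fin.suc-injective))

  -- The shift v carries the contribution of variables already fixed, so that columns can be removed
  -- one at a time; the system itself has shift zero.
  W : LinearSystem 2 k → Vector ℤ k → Vector ℤ k → ℤ → ℤ → ℤ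
  W {k} L a b v₀ v₁ = ∑[ ξ ∈ allVecs (List.allFin p) k ]
    (χ (v₀ + dot (L 0F) ξ) * χ (v₁ + dot (L 1F) ξ)) * prod (λ j → a j + b j * δ (lookup ξ j))

  W-suc : ∀ (L : LinearSystem 2 (suc k)) a b v₀ v₁ →
    W L a b v₀ v₁ ≡ a zero * (∑[ c ∈ List.allFin p ] W (tailSystem L) (a ∘ suc) (b ∘ suc) (v₀ + L 0F zero * + toℕ c) (v₁ + L 1F zero * + toℕ c))
                  + b zero * W (tailSystem L) (a ∘ suc) (b ∘ suc) v₀ v₁
  W-suc {k} L a b v₀ v₁ = begin
    W L a b v₀ v₁
      ≡⟨ ∑-allVecs-suc (List.allFin p) k _ ⟩
    (∑[ c ∈ List.allFin p ] ∑[ ξ ∈ allVecs (List.allFin p) k ]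
      (χ (v₀ + (L 0F zero * + toℕ c + dot (L′ 0F) ξ)) * χ (v₁ + (L 1F zero * + toℕ c + dot (L′ 1F) ξ))) * ((a zero + b zero * δ c) * Π ξ))
      ≡⟨ ∑-cong (List.allFin p) (λ c → trans (∑-cong (allVecs (List.allFin p) k) (λ ξ →
           trans (cong₂ (λ x y → (χ x * χ y) * ((a zero + b zero * δ c) * Π ξ))
                   (sym (ℤ.+-assoc v₀ (L 0F zero * + toℕ c) _)) (sym (ℤ.+-assoc v₁ (L 1F zero * + toℕ c) _)))
                 (ring (χ (v₀ + L 0F zero * + toℕ c + dot (L′ 0F) ξ) * χ (v₁ + L 1F zero * + toℕ c + dot (L′ 1F) ξ)) (a zero + b zero * δ c) (Π ξ))))
           (∑-*ˡ (allVecs (List.allFin p) k) (a zero + b zero * δ c) _)) ⟩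
    (∑[ c ∈ List.allFin p ] (a zero + b zero * δ c) * φ (+ toℕ c))
      ≡⟨ ∑-affine-δ p (a zero) (b zero) φ ⟩
    a zero * (∑[ c ∈ List.allFin p ] φ (+ toℕ c)) + b zero * φ (+ 0)
      ≡⟨ cong (λ z → a zero * (∑[ c ∈ List.allFin p ] φ (+ toℕ c)) + b zero * z) (cong₂ (W L′ (a ∘ suc) (b ∘ suc)) (at-0 v₀ (L 0F zero)) (at-0 v₁ (L 1F zero))) ⟩
    a zero * (∑[ c ∈ List.allFin p ] φ (+ toℕ c)) + b zero * W L′ (a ∘ suc) (b ∘ suc) v₀ v₁ ∎
    where
    L′ = tailSystem L
    Π : Vec (Fin p) k → ℤ
    Π ξ = prod (λ j → a (suc j) + b (suc j) * δ (lookup ξ j))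
    φ : ℤ → ℤ
    φ c = W L′ (a ∘ suc) (b ∘ suc) (v₀ + L 0F zero * c) (v₁ + L 1F zero * c)
    ring : ∀ x y z → x * (y * z) ≡ y * (x * z)
    ring = solve-∀
    at-0 : ∀ v ℓ → v + ℓ * + 0 ≡ v
    at-0 = solve-∀

  -- In the group ring of 𝔽_p², the sum W is the coefficient at -v of the
  -- product of the a_j [line spanned by column j] + b_j [0]; two distinct
  -- lines convolve to the constant function, which leaves only the three
  -- kinds of terms below.
  W-formula : ∀ (L : LinearSystem 2 k) a b v₀ v₁ → GeneralPosition L →
    + p * + p * W L a b v₀ v₁ ≡
    + p * + p * (prod b * (χ v₀ * χ v₁)) + + p * + p * lines L a b v₀ v₁
    + (prod (λ j → + p * a j + b j) - prod b - + p * mixed a b)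
  W-formula {zero} L a b v₀ v₁ gp = trans
    (cong₂ (λ x y → + p * + p * (χ x * χ y * + 1 + + 0)) (ℤ.+-identityʳ v₀) (ℤ.+-identityʳ v₁))
    (ring (+ p) (χ v₀ * χ v₁))
    where
    ring : ∀ p x → p * p * (x * + 1 + + 0) ≡ p * p * (+ 1 * x) + p * p * + 0 + (+ 1 - + 1 - p * + 0)
    ring = solve-∀
  W-formula {suc k} L a b v₀ v₁ gp = begin
    + p * + p * W L a b v₀ v₁
      ≡⟨ cong (_*_ (+ p * + p)) (W-suc L a b v₀ v₁) ⟩
    + p * + p * (a zero * (∑[ c ∈ List.allFin p ] W L′ a′ b′ (V₀ c) (V₁ c)) + b zero * W L′ a′ b′ v₀ v₁)
      ≡⟨ ring₁ (+ p * + p) (a zero) _ (b zero) _ ⟩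
    a zero * (+ p * + p * (∑[ c ∈ List.allFin p ] W L′ a′ b′ (V₀ c) (V₁ c))) + b zero * (+ p * + p * W L′ a′ b′ v₀ v₁)
      ≡⟨ cong₂ (λ x y → a zero * x + b zero * y) average-step (W-formula L′ a′ b′ v₀ v₁ gp′) ⟩
    a zero * (+ p * + p * (prod b′ * χ (v₀ * L 1F zero - v₁ * L 0F zero)) + + p * + p * mixed a′ b′ + + p * T)
      + b zero * (+ p * + p * (prod b′ * (χ v₀ * χ v₁)) + + p * + p * lines L′ a′ b′ v₀ v₁ + T)
      ≡⟨ ring₂ (+ p) (a zero) (b zero) (prod b′) (mixed a′ b′) (prod (λ j → + p * a′ j + b′ j)) (χ v₀ * χ v₁) (χ (v₀ * L 1F zero - v₁ * L 0F zero)) (lines L′ a′ b′ v₀ v₁) ⟩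
    + p * + p * (prod b * (χ v₀ * χ v₁)) + + p * + p * lines L a b v₀ v₁
      + (prod (λ j → + p * a j + b j) - prod b - + p * mixed a b) ∎
    where
    L′ = tailSystem L
    a′ = a ∘ suc
    b′ = b ∘ suc
    gp′ = generalPosition-tail gp
    V₀ V₁ : Fin p → ℤ
    V₀ c = v₀ + L 0F zero * + toℕ c
    V₁ c = v₁ + L 1F zero * + toℕ c
    T = prod (λ j → + p * a′ j + b′ j) - prod b′ - + p * mixed a′ b′
    P = List.allFin p
    ring₁ : ∀ q a x b y → q * (a * x + b * y) ≡ a * (q * x) + b * (q * y)
    ring₁ = solve-∀
    ring₂ : ∀ p a b B M Π x y l →
      a * (p * p * (B * y) + p * p * M + p * (Π - B - p * M)) + b * (p * p * (B * x) + p * p * l + (Π - B - p * M))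
      ≡ p * p * (b * B * x) + p * p * (a * B * y + b * l) + ((p * a + b) * Π - b * B - p * (a * B + b * M))
    ring₂ = solve-∀
    -- Convolution with the line of the first column: the point mass becomes that line, every other
    -- line becomes the constant 1, and a constant is multiplied by `p`.
    average-step : + p * + p * (∑[ c ∈ P ] W L′ a′ b′ (V₀ c) (V₁ c)) ≡
      + p * + p * (prod b′ * χ (v₀ * L 1F zero - v₁ * L 0F zero)) + + p * + p * mixed a′ b′ + + p * T
    average-step = begin
      + p * + p * (∑[ c ∈ P ] W L′ a′ b′ (V₀ c) (V₁ c))
        ≡⟨ ∑-*ˡ P (+ p * + p) _ ⟨
      (∑[ c ∈ P ] + p * + p * W L′ a′ b′ (V₀ c) (V₁ c))
        ≡⟨ ∑-cong P (λ c → W-formula L′ a′ b′ (V₀ c) (V₁ c) gp′) ⟩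
      (∑[ c ∈ P ] + p * + p * (prod b′ * (χ (V₀ c) * χ (V₁ c))) + + p * + p * lines L′ a′ b′ (V₀ c) (V₁ c) + T)
        ≡⟨ trans (∑-+ P _ _) (cong₂ _+_ (∑-+ P _ _) (∑-allFin-const p T)) ⟩
      (∑[ c ∈ P ] + p * + p * (prod b′ * (χ (V₀ c) * χ (V₁ c)))) + (∑[ c ∈ P ] + p * + p * lines L′ a′ b′ (V₀ c) (V₁ c)) + + p * T
        ≡⟨ cong₂ (λ x y → x + y + + p * T)
             (trans (∑-*ˡ P (+ p * + p) _) (cong (_*_ (+ p * + p)) (trans (∑-*ˡ P (prod b′) _)
               (cong (_*_ (prod b′)) (∑-χχ v₀ v₁ (L 0F zero) (L 1F zero) (column≢0 gp zero))))))
             (trans (∑-*ˡ P (+ p * + p) _) (cong (_*_ (+ p * + p)) (∑-lines L′ a′ b′ v₀ v₁ (L 0F zero) (L 1F zero) (λ j → minor≢0 gp zero (suc j) λ ())))) ⟩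
      + p * + p * (prod b′ * χ (v₀ * L 1F zero - v₁ * L 0F zero)) + + p * + p * mixed a′ b′ + + p * T ∎

  -- Moments of `u` over solutions in 𝔽_p.

  u : Fin p → ℤ
  u c = + p * δ c - + 1

  isSolution₁ : LinearSystem 2 k → Vec (Fin p) k → ℤ
  isSolution₁ L ξ = χ (dot (L 0F) ξ) * χ (dot (L 1F) ξ)

  -- E₁ and E are unnormalised: they are sums over solutions, not averages.
  E₁ : LinearSystem 2 k → (Vec (Fin p) k → ℤ) → ℤ
  E₁ {k} L φ = ∑[ ξ ∈ allVecs (List.allFin p) k ] isSolution₁ L ξ * φ ξ

  E₁-cong : ∀ (L : LinearSystem 2 k) {φ ψ : Vec (Fin p) k → ℤ} → (∀ ξ → φ ξ ≡ ψ ξ) → E₁ L φ ≡ E₁ L ψ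
  E₁-cong {k} L φ≗ψ = ∑-cong (allVecs (List.allFin p) k) (λ ξ → cong (_*_ (isSolution₁ L ξ)) (φ≗ψ ξ))

  E₁-+ : ∀ (L : LinearSystem 2 k) (φ ψ : Vec (Fin p) k → ℤ) → E₁ L (λ ξ → φ ξ + ψ ξ) ≡ E₁ L φ + E₁ L ψ
  E₁-+ {k} L φ ψ = trans (∑-cong (allVecs (List.allFin p) k) (λ ξ → ℤ.*-distribˡ-+ (isSolution₁ L ξ) (φ ξ) (ψ ξ)))
    (∑-+ (allVecs (List.allFin p) k) (λ ξ → isSolution₁ L ξ * φ ξ) (λ ξ → isSolution₁ L ξ * ψ ξ))

  E₁-*ˡ : ∀ (L : LinearSystem 2 k) c (φ : Vec (Fin p) k → ℤ) → E₁ L (λ ξ → c * φ ξ) ≡ c * E₁ L φ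
  E₁-*ˡ {k} L c φ = trans (∑-cong (allVecs (List.allFin p) k) (λ ξ → ring (isSolution₁ L ξ) c (φ ξ)))
    (∑-*ˡ (allVecs (List.allFin p) k) c (λ ξ → isSolution₁ L ξ * φ ξ))
    where
    ring : ∀ s c x → s * (c * x) ≡ c * (s * x)
    ring = solve-∀

  E₁-sumℤ : ∀ (L : LinearSystem 2 k) n (φ : Fin n → Vec (Fin p) k → ℤ) →
            E₁ L (λ ξ → sumℤ (λ j → φ j ξ)) ≡ sumℤ (λ j → E₁ L (φ j))
  E₁-sumℤ {k} L zero    φ = trans (∑-cong (allVecs (List.allFin p) k) (λ ξ → ℤ.*-zeroʳ (isSolution₁ L ξ))) (∑-zero (allVecs (List.allFin p) k))
  E₁-sumℤ {k} L (suc n) φ = trans (E₁-+ L (φ zero) (λ ξ → sumℤ (λ j → φ (suc j) ξ))) (cong (_+_ (E₁ L (φ zero))) (E₁-sumℤ L n (φ ∘ suc)))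

  -- p^(k-2) γ and p^(k-2) κ k are the sums over all one-dimensional solutions
  -- of the products of u over all but one coordinate and over all coordinates;
  -- see E₁-prod.
  γ : ℤ
  γ = + p - + 1

  κ : ℕ → ℤ
  κ k = + p * + p - + 1 - + k * γ

  K : Vector ℤ k → Vector ℤ k → ℤ
  K {k} α β = γ * mixed α β + κ k * prod β

  lines-0 : ∀ (L : LinearSystem 2 k) a b → lines L a b (+ 0) (+ 0) ≡ mixed a b
  lines-0 {zero}  L a b = refl
  lines-0 {suc k} L a b = cong₂ _+_ {y = a zero * prod (b ∘ suc)}
    (trans (cong (λ z → a zero * prod (b ∘ suc) * χ z) (ring (L 0F zero) (L 1F zero)))
      (trans (cong (_*_ (a zero * prod (b ∘ suc))) (⟦⟧-yes (+ p ∣ℤ? + 0) (divides (+ 0) refl))) (ℤ.*-identityʳ (a zero * prod (b ∘ suc)))))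
    (cong (_*_ (b zero)) (lines-0 (tailSystem L) (a ∘ suc) (b ∘ suc)))
    where
    ring : ∀ x y → + 0 * y - + 0 * x ≡ + 0
    ring = solve-∀

  linear : Vector ℤ k → Vector ℤ k → Vec (Fin p) k → Vector ℤ k
  linear α β ξ j = α j + β j * u (lookup ξ j)

  -- Rewriting α + βu as (α - β) + pβδ gives a sum `W` with shift zero, and p(α - β) + pβ = pα
  -- produces the term `prod α`. Of the expansion in products of values of `u`, only the products
  -- over none, all but one, or all of the coordinates survive. The factor p² of `W-formula` is
  -- cancelled at the end.
  E₁-prod : ∀ (L : LinearSystem 2 (suc (suc k))) → GeneralPosition L → ∀ α β →
            E₁ L (λ ξ → prod (λ j → α j + β j * u (lookup ξ j))) ≡ (+ p) ℤ.^ k * (prod α + K α β)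
  E₁-prod {k} L gp α β = ℤ.*-cancelˡ-≡ (+ p * + p) _ _ {{ℤ.i*j≢0 (+ p) (+ p)}} (begin
    + p * + p * E₁ L (λ ξ → prod (λ j → α j + β j * u (lookup ξ j)))
      ≡⟨ cong (_*_ (+ p * + p)) (∑-cong (allVecs (List.allFin p) (suc (suc k))) to-W) ⟩
    + p * + p * W L a b (+ 0) (+ 0)
      ≡⟨ W-formula L a b (+ 0) (+ 0) gp ⟩
    + p * + p * (prod b * (χ (+ 0) * χ (+ 0))) + + p * + p * lines L a b (+ 0) (+ 0) + (prod (λ j → + p * a j + b j) - prod b - + p * mixed a b)
      ≡⟨ cong₂ (λ x l → + p * + p * (prod b * (x * x)) + + p * + p * l + (prod (λ j → + p * a j + b j) - prod b - + p * mixed a b))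
           (⟦⟧-yes (+ p ∣ℤ? + 0) (divides (+ 0) refl)) (lines-0 L a b) ⟩
    + p * + p * (prod b * + 1) + + p * + p * mixed a b + (prod (λ j → + p * a j + b j) - prod b - + p * mixed a b)
      ≡⟨ ring₁ (+ p) (prod b) (mixed a b) (prod (λ j → + p * a j + b j)) ⟩
    prod (λ j → + p * a j + b j) + (+ p * + p - + 1) * prod b + γ * (+ p * mixed a b)
      ≡⟨ cong₂ _+_ (cong₂ (λ x y → x + (+ p * + p - + 1) * y)
           (trans (prod-cong (λ j → ring₂ (+ p) (α j) (β j))) (prod-*ˡ (+ p) α)) (prod-*ˡ (+ p) β))
           (cong (_*_ γ) (trans (mixed-*ˡ (+ p) a β) (cong (_*_ ((+ p) ℤ.^ suc (suc k))) (mixed-sub-diagonal α β)))) ⟩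
    (+ p) ℤ.^ suc (suc k) * prod α + (+ p * + p - + 1) * ((+ p) ℤ.^ suc (suc k) * prod β)
      + γ * ((+ p) ℤ.^ suc (suc k) * (mixed α β - + suc (suc k) * prod β))
      ≡⟨ ring₃ (+ p) ((+ p) ℤ.^ k) (prod α) (prod β) (mixed α β) (+ suc (suc k)) ⟩
    + p * + p * ((+ p) ℤ.^ k * (prod α + K α β)) ∎)
    where
    a b : Vector ℤ (suc (suc k))
    a j = α j - β j
    b j = + p * β j
    ring₀ : ∀ p α β d → α + β * (p * d - + 1) ≡ (α - β) + p * β * d
    ring₀ = solve-∀
    to-W : ∀ ξ → isSolution₁ L ξ * prod (λ j → α j + β j * u (lookup ξ j)) ≡
      (χ (+ 0 + dot (L 0F) ξ) * χ (+ 0 + dot (L 1F) ξ)) * prod (λ j → a j + b j * δ (lookup ξ j))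
    to-W ξ = cong₂ _*_
      (cong₂ (λ x y → χ x * χ y) (sym (ℤ.+-identityˡ (dot (L 0F) ξ))) (sym (ℤ.+-identityˡ (dot (L 1F) ξ))))
      (prod-cong (λ j → ring₀ (+ p) (α j) (β j) (δ (lookup ξ j))))
    ring₁ : ∀ p B M Π → p * p * (B * + 1) + p * p * M + (Π - B - p * M) ≡ Π + (p * p - + 1) * B + (p - + 1) * (p * M)
    ring₁ = solve-∀
    ring₂ : ∀ p α β → p * (α - β) + p * β ≡ p * α
    ring₂ = solve-∀
    ring₃ : ∀ p P A B M k → p * (p * P) * A + (p * p - + 1) * (p * (p * P) * B) + (p - + 1) * (p * (p * P) * (M - k * B))
      ≡ p * p * (P * (A + ((p - + 1) * M + (p * p - + 1 - k * (p - + 1)) * B)))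
    ring₃ = solve-∀

  -- By `mixed-swap` the integrand is a sum of products of linear forms in the values of `u`, and
  -- `E₁-prod` applies to each of them.
  E₁-mixed : ∀ (L : LinearSystem 2 (suc (suc k))) → GeneralPosition L → ∀ A B A′ B′ →
    E₁ L (λ ξ → mixed (λ j → A j + B j * u (lookup ξ j)) (λ j → A′ j + B′ j * u (lookup ξ j)))
    ≡ (+ p) ℤ.^ k * (mixed A A′ + (γ * mixed₂ A B A′ B′ + κ (suc (suc k)) * mixed B B′))
  E₁-mixed {k} L gp A B A′ B′ = begin
    E₁ L (λ ξ → mixed (linear A B ξ) (linear A′ B′ ξ))
      ≡⟨ E₁-cong L (λ ξ → trans (mixed-swap (linear A B ξ) (linear A′ B′ ξ))
           (sumℤ-cong (λ j → prod-cong (updateAt-zip A B A′ B′ (λ j → u (lookup ξ j)) j)))) ⟩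
    E₁ L (λ ξ → sumℤ (λ j → prod (linear (A″ j) (B″ j) ξ)))
      ≡⟨ E₁-sumℤ L (suc (suc k)) (λ j ξ → prod (linear (A″ j) (B″ j) ξ)) ⟩
    sumℤ (λ j → E₁ L (λ ξ → prod (linear (A″ j) (B″ j) ξ)))
      ≡⟨ sumℤ-cong (λ j → E₁-prod L gp (A″ j) (B″ j)) ⟩
    sumℤ (λ j → P * (prod (A″ j) + (γ * mixed (A″ j) (B″ j) + κ′ * prod (B″ j))))
      ≡⟨ *-distribˡ-sum P (λ j → prod (A″ j) + (γ * mixed (A″ j) (B″ j) + κ′ * prod (B″ j))) ⟨
    P * sumℤ (λ j → prod (A″ j) + (γ * mixed (A″ j) (B″ j) + κ′ * prod (B″ j)))
      ≡⟨ cong (_*_ P) (trans (∑-distrib-+ (λ j → prod (A″ j)) (λ j → γ * mixed (A″ j) (B″ j) + κ′ * prod (B″ j)))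
           (cong₂ _+_ (sym (mixed-swap A A′))
             (trans (∑-distrib-+ (λ j → γ * mixed (A″ j) (B″ j)) (λ j → κ′ * prod (B″ j)))
               (cong₂ _+_ (sym (*-distribˡ-sum γ (λ j → mixed (A″ j) (B″ j))))
                 (trans (sym (*-distribˡ-sum κ′ (λ j → prod (B″ j)))) (cong (_*_ κ′) (sym (mixed-swap B B′)))))))) ⟩
    P * (mixed A A′ + (γ * mixed₂ A B A′ B′ + κ′ * mixed B B′)) ∎
    where
    P = (+ p) ℤ.^ k
    κ′ = κ (suc (suc k))
    A″ B″ : Fin (suc (suc k)) → Vector ℤ (suc (suc k))
    A″ j = updateAt A′ j (λ _ → A j)
    B″ j = updateAt B′ j (λ _ → B j)

  E₁-one : ∀ (L : LinearSystem 2 (suc (suc k))) → GeneralPosition L → E₁ L (λ _ → + 1) ≡ (+ p) ℤ.^ k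
  E₁-one {k} L gp = begin
    E₁ L (λ _ → + 1)
      ≡⟨ E₁-cong L (λ ξ → sym (trans (prod-const (suc (suc k)) (+ 1)) (ℤ.^-zeroˡ (suc (suc k))))) ⟩
    E₁ L (λ ξ → prod {suc (suc k)} (λ _ → + 1))
      ≡⟨ E₁-prod L gp (λ _ → + 1) (λ _ → + 0) ⟩
    (+ p) ℤ.^ k * (prod {suc (suc k)} (λ _ → + 1) + K {suc (suc k)} (λ _ → + 1) (λ _ → + 0))
      ≡⟨ cong (λ x → (+ p) ℤ.^ k * (x + K {suc (suc k)} (λ _ → + 1) (λ _ → + 0))) (trans (prod-const (suc (suc k)) (+ 1)) (ℤ.^-zeroˡ (suc (suc k)))) ⟩
    (+ p) ℤ.^ k * (+ 1 + (γ * + 0 + κ (suc (suc k)) * + 0))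
      ≡⟨ ring ((+ p) ℤ.^ k) γ (κ (suc (suc k))) ⟩
    (+ p) ℤ.^ k ∎
    where
    ring : ∀ P γ κ → P * (+ 1 + (γ * + 0 + κ * + 0)) ≡ P
    ring = solve-∀

  -- The added part consists of multiples of single values of `u`, which have mean zero over the
  -- solutions when there are at least three columns.
  E₁-mixed-mean : ∀ (L : LinearSystem 2 (suc (suc (suc k)))) → GeneralPosition L → ∀ α β →
    E₁ L (λ ξ → mixed (λ j → α j + β j * u (lookup ξ j)) β) ≡ (+ p) ℤ.^ suc k * mixed α β
  E₁-mixed-mean {k} L gp α β = begin
    E₁ L (λ ξ → mixed (linear α β ξ) β)
      ≡⟨ E₁-cong L (λ ξ → mixed-cong {α = linear α β ξ} {β = β} (λ _ → refl) (λ j → sym (ring₁ (β j) (u (lookup ξ j))))) ⟩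
    E₁ L (λ ξ → mixed (linear α β ξ) (linear β (λ _ → + 0) ξ))
      ≡⟨ E₁-mixed L gp α β β (λ _ → + 0) ⟩
    P * (mixed α β + (γ * mixed₂ α β β (λ _ → + 0) + κ′ * mixed β (λ _ → + 0)))
      ≡⟨ cong₂ (λ x y → P * (mixed α β + (γ * x + κ′ * y)))
           (trans (sumℤ-cong (λ j → mixed-single (updateAt β j (λ _ → α j)) j (β j)))
             (trans (sumℤ-const (suc (suc (suc k))) (+ 0)) (ℤ.*-zeroʳ (+ suc (suc (suc k)))))) (mixed-zero β) ⟩
    P * (mixed α β + (γ * + 0 + κ′ * + 0))
      ≡⟨ ring₂ P (mixed α β) γ κ′ ⟩
    P * mixed α β ∎
    where
    P = (+ p) ℤ.^ suc k
    κ′ = κ (suc (suc (suc k)))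
    ring₁ : ∀ b u → b + + 0 * u ≡ b
    ring₁ = solve-∀
    ring₂ : ∀ P M γ κ → P * (M + (γ * + 0 + κ * + 0)) ≡ P * M
    ring₂ = solve-∀

  -- Sums over solutions in 𝔽_p^n, by recursion on n.

  cube : ∀ n → List (𝔽^ p n)
  cube n = allVecs (List.allFin p) n

  E : ∀ n → LinearSystem 2 k → (Vec (𝔽^ p n) k → ℤ) → ℤ
  E {k} n L Φ = ∑[ x ∈ allVecs (cube n) k ] ⟦ isSolution? L x ⟧ * Φ x

  E-cong : ∀ n (L : LinearSystem 2 k) {Φ Ψ : Vec (𝔽^ p n) k → ℤ} → (∀ x → Φ x ≡ Ψ x) → E n L Φ ≡ E n L Ψ
  E-cong {k} n L Φ≗Ψ = ∑-cong (allVecs (cube n) k) (λ x → cong (_*_ ⟦ isSolution? L x ⟧) (Φ≗Ψ x))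

  isSolution-zipWith : ∀ (L : LinearSystem 2 k) (ξ : Vec (Fin p) k) (x : Vec (𝔽^ p n) k) →
    ⟦ isSolution? L (zipWith _∷_ ξ x) ⟧ ≡ isSolution₁ L ξ * ⟦ isSolution? L x ⟧
  isSolution-zipWith {k} L ξ x = trans
    (⟦⟧-× (isSolution? L (zipWith _∷_ ξ x)) (d₀ ×-dec d₁) (isSolution? L x)
      (λ sol → (subst (+ p ∣ℤ_) (head-eq 0F) (sol 0F zero) , subst (+ p ∣ℤ_) (head-eq 1F) (sol 1F zero))
             , λ i c → subst (+ p ∣ℤ_) (tail-eq i c) (sol i (suc c)))
      (λ { (h₀ , h₁) sol 0F zero → subst (+ p ∣ℤ_) (sym (head-eq 0F)) h₀
         ; (h₀ , h₁) sol 1F zero → subst (+ p ∣ℤ_) (sym (head-eq 1F)) h₁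
         ; (h₀ , h₁) sol i (suc c) → subst (+ p ∣ℤ_) (sym (tail-eq i c)) (sol i c) }))
    (cong (_* ⟦ isSolution? L x ⟧) (⟦⟧-× (d₀ ×-dec d₁) d₀ d₁ id _,_))
    where
    d₀ = + p ∣ℤ? dot (L 0F) ξ
    d₁ = + p ∣ℤ? dot (L 1F) ξ
    head-eq : ∀ i → sumℤ (λ j → L i j * + toℕ (lookup (lookup (zipWith _∷_ ξ x) j) zero)) ≡ dot (L i) ξ
    head-eq i = sumℤ-cong (λ j → cong (λ v → L i j * + toℕ (lookup v zero)) (lookup-zipWith _∷_ j ξ x))
    tail-eq : ∀ i c → sumℤ (λ j → L i j * + toℕ (lookup (lookup (zipWith _∷_ ξ x) j) (suc c))) ≡ sumℤ (λ j → L i j * + toℕ (lookup (lookup x j) c))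
    tail-eq i c = sumℤ-cong (λ j → cong (λ v → L i j * + toℕ (lookup v (suc c))) (lookup-zipWith _∷_ j ξ x))

  E-suc : ∀ n (L : LinearSystem 2 k) (Φ : Vec (𝔽^ p (suc n)) k → ℤ) →
          E (suc n) L Φ ≡ E₁ L (λ ξ → E n L (λ x → Φ (zipWith _∷_ ξ x)))
  E-suc {k} n L Φ = trans
    (∑-transpose (List.allFin p) n k (λ x → ⟦ isSolution? L x ⟧ * Φ x))
    (∑-cong (allVecs (List.allFin p) k) (λ ξ → trans
      (∑-cong (allVecs (cube n) k) (λ x → trans
        (cong (_* Φ (zipWith _∷_ ξ x)) (isSolution-zipWith L ξ x))
        (ℤ.*-assoc (isSolution₁ L ξ) ⟦ isSolution? L x ⟧ (Φ (zipWith _∷_ ξ x)))))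
      (∑-*ˡ (allVecs (cube n) k) (isSolution₁ L ξ) (λ x → ⟦ isSolution? L x ⟧ * Φ (zipWith _∷_ ξ x)))))

  E-prod-suc : ∀ n (L : LinearSystem 2 k) (φ : Fin k → 𝔽^ p (suc n) → ℤ) →
    E (suc n) L (λ x → prod (λ j → φ j (lookup x j))) ≡
    E₁ L (λ ξ → E n L (λ x → prod (λ j → φ j (lookup ξ j ∷ lookup x j))))
  E-prod-suc n L φ = trans (E-suc n L (λ x → prod (λ j → φ j (lookup x j))))
    (E₁-cong L (λ ξ → E-cong n L (λ x → prod-cong (λ j → cong (φ j) (lookup-zipWith _∷_ j ξ x)))))

  E-zero : ∀ (L : LinearSystem 2 k) (φ : Fin k → 𝔽^ p zero → ℤ) → E zero L (λ x → prod (λ j → φ j (lookup x j))) ≡ prod (λ j → φ j [])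
  E-zero {k} L φ = trans
    (∑-cong (allVecs (cube zero) k) (λ x → trans
      (cong₂ _*_ (⟦⟧-yes (isSolution? L x) (λ _ ())) (prod-cong (λ j → cong (φ j) (empty (lookup x j)))))
      (ℤ.*-identityˡ (prod (λ j → φ j [])))))
    (single k)
    where
    empty : (v : 𝔽^ p zero) → v ≡ []
    empty [] = refl
    single : ∀ m {z} → ∑ (allVecs (cube zero) m) (λ _ → z) ≡ z
    single zero        = ℤ.+-identityʳ _
    single (suc m) {z} = trans (∑-allVecs-suc (cube zero) m (λ _ → z)) (trans (ℤ.+-identityʳ _) (single m))

  total : 𝔽^ p n → ℤ
  total []      = + 0
  total (c ∷ x) = u c + total x

  -- Fix the first coordinates and absorb their contribution β u into α, which is why α is
  -- arbitrary; the induction hypothesis handles the rest. Averaged over the first coordinates,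
  -- `prod` of the new α yields one more `K α β`, while `K` of it returns to `K α β` by
  -- `E₁-mixed-mean`. Thus `K` adds up over coordinates without cross terms.
  E-prod : ∀ n (L : LinearSystem 2 (suc (suc (suc k)))) → GeneralPosition L → ∀ α β →
    E n L (λ x → prod (λ j → α j + β j * total (lookup x j))) ≡
    ((+ p) ℤ.^ suc k) ℤ.^ n * (prod α + + n * K α β)
  E-prod {k} zero    L gp α β = trans (E-zero L (λ j v → α j + β j * total v))
    (trans (prod-cong (λ j → ring₁ (α j) (β j))) (ring₂ (prod α) (K α β)))
    where
    ring₁ : ∀ a b → a + b * + 0 ≡ a
    ring₁ = solve-∀
    ring₂ : ∀ a k → a ≡ + 1 * (a + + 0 * k)
    ring₂ = solve-∀
  E-prod {k} (suc n) L gp α β = begin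
    E (suc n) L (λ x → prod (λ j → α j + β j * total (lookup x j)))
      ≡⟨ E-prod-suc n L (λ j v → α j + β j * total v) ⟩
    E₁ L (λ ξ → E n L (λ x → prod (λ j → α j + β j * (u (lookup ξ j) + total (lookup x j)))))
      ≡⟨ E₁-cong L (λ ξ → trans
           (E-cong n L (λ x → prod-cong (λ j → ring₁ (α j) (β j) (u (lookup ξ j)) (total (lookup x j)))))
           (E-prod n L gp (α′ ξ) β)) ⟩
    E₁ L (λ ξ → Q * (prod (α′ ξ) + + n * (γ * mixed (α′ ξ) β + κ′ * prod β)))
      ≡⟨ E₁-cong L (λ ξ → ring₂ Q (prod (α′ ξ)) (+ n) γ (mixed (α′ ξ) β) (κ′ * prod β)) ⟩
    E₁ L (λ ξ → Q * prod (α′ ξ) + (Q * + n * γ * mixed (α′ ξ) β + Q * + n * (κ′ * prod β) * + 1))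
      ≡⟨ trans (E₁-+ L _ _) (cong₂ _+_ (E₁-*ˡ L Q (λ ξ → prod (α′ ξ))) (trans (E₁-+ L _ _)
           (cong₂ _+_ (E₁-*ˡ L (Q * + n * γ) (λ ξ → mixed (α′ ξ) β)) (E₁-*ˡ L (Q * + n * (κ′ * prod β)) (λ _ → + 1))))) ⟩
    Q * E₁ L (λ ξ → prod (α′ ξ)) + (Q * + n * γ * E₁ L (λ ξ → mixed (α′ ξ) β) + Q * + n * (κ′ * prod β) * E₁ L (λ _ → + 1))
      ≡⟨ cong₂ (λ x y → Q * x + y) (E₁-prod L gp α β)
           (cong₂ (λ x y → Q * + n * γ * x + Q * + n * (κ′ * prod β) * y) (E₁-mixed-mean L gp α β) (E₁-one L gp)) ⟩
    Q * (P * (prod α + (γ * mixed α β + κ′ * prod β))) + (Q * + n * γ * (P * mixed α β) + Q * + n * (κ′ * prod β) * P)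
      ≡⟨ ring₃ Q P (prod α) γ (mixed α β) κ′ (prod β) (+ n) ⟩
    P * Q * (prod α + + suc n * K α β) ∎
    where
    P = (+ p) ℤ.^ suc k
    Q = P ℤ.^ n
    κ′ = κ (suc (suc (suc k)))
    α′ : Vec (Fin p) (suc (suc (suc k))) → Vector ℤ (suc (suc (suc k)))
    α′ ξ j = α j + β j * u (lookup ξ j)
    ring₁ : ∀ a b u t → a + b * (u + t) ≡ a + b * u + b * t
    ring₁ = solve-∀
    ring₂ : ∀ Q A n γ M B → Q * (A + n * (γ * M + B)) ≡ Q * A + (Q * n * γ * M + Q * n * B * + 1)
    ring₂ = solve-∀
    ring₃ : ∀ Q P A γ M κ B n → Q * (P * (A + (γ * M + κ * B))) + (Q * n * γ * (P * M) + Q * n * (κ * B) * P)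
      ≡ P * Q * (A + (+ 1 + n) * (γ * M + κ * B))
    ring₃ = solve-∀

  -- The function `g` and its solution sums.

  g : 𝔽^ p (suc n) → ℤ
  g (y ∷ x) = (+ 1 + u y) * total x - + p * u y

  -- Evenness in the form in which it is applied, to the signs `s` and `- s`; the exponent is the
  -- number of columns minus two.
  SignPower : ℕ → Set
  SignPower n = ∀ s → s * s ≡ + 1 → s ℤ.^ n ≡ + 1

  -- For fixed y the factor D + s g is affine in F(x), with constant term D - s p u(y) and slope s
  -- (1 + u(y)). So `E-prod` evaluates the sum over x, and what remains is a one-dimensional sum
  -- over the y. The part free of `n` comes from the constant terms alone, the part linear in `n`
  -- from k - 1 or k factors F, where k counts the columns.
  E-shifted : ∀ n (L : LinearSystem 2 (suc (suc (suc k)))) → GeneralPosition L → SignPower (suc k) → ∀ D s → s * s ≡ + 1 →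
    let P  = (+ p) ℤ.^ suc k
        q  = + p
        m′ = + suc (suc k)
        m  = + 1 + m′
        κ′ = κ (suc (suc (suc k)))
    in E (suc n) L (λ x → prod (λ j → D + s * g (lookup x j))) ≡
       P ℤ.^ n * P * ((D ℤ.^ suc (suc (suc k)) + (γ * (m * (D * (- s * q * P))) + κ′ * (q * q * P)))
         + + n * (γ * (m * (D * s) + (γ * (m * (D * s - q * m′)) + κ′ * - (m * q))) + κ′ * (+ 1 + (γ * m + κ′ * + 1))))
  E-shifted {k} n L gp even D s s²≡1 = begin
    E (suc n) L (λ x → prod (λ j → D + s * g (lookup x j)))
      ≡⟨ E-prod-suc n L (λ j v → D + s * g v) ⟩
    E₁ L (λ ξ → E n L (λ x → prod (λ j → D + s * ((+ 1 + u (lookup ξ j)) * total (lookup x j) - q * u (lookup ξ j)))))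
      ≡⟨ E₁-cong L (λ ξ → trans
           (E-cong n L (λ x → prod-cong (λ j → ring₁ D s q (u (lookup ξ j)) (total (lookup x j)))))
           (E-prod n L gp (α ξ) (β ξ))) ⟩
    E₁ L (λ ξ → Q * (prod (α ξ) + + n * (γ * mixed (α ξ) (β ξ) + κ′ * prod (β ξ))))
      ≡⟨ E₁-cong L (λ ξ → ring₂ Q (prod (α ξ)) (+ n) γ (mixed (α ξ) (β ξ)) κ′ (prod (β ξ))) ⟩
    E₁ L (λ ξ → Q * prod (α ξ) + (Q * + n * γ * mixed (α ξ) (β ξ) + Q * + n * κ′ * prod (β ξ)))
      ≡⟨ trans (E₁-+ L _ _) (cong₂ _+_ (E₁-*ˡ L Q (λ ξ → prod (α ξ))) (trans (E₁-+ L _ _)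
           (cong₂ _+_ (E₁-*ˡ L (Q * + n * γ) (λ ξ → mixed (α ξ) (β ξ))) (E₁-*ˡ L (Q * + n * κ′) (λ ξ → prod (β ξ)))))) ⟩
    Q * E₁ L (λ ξ → prod (α ξ)) + (Q * + n * γ * E₁ L (λ ξ → mixed (α ξ) (β ξ)) + Q * + n * κ′ * E₁ L (λ ξ → prod (β ξ)))
      ≡⟨ cong₂ (λ x y → Q * x + y) ∑-α (cong₂ (λ x y → Q * + n * γ * x + Q * + n * κ′ * y) ∑-mixed ∑-β) ⟩
    Q * (P * (D ℤ.^ k₃ + (γ * (m * (D * (- s * q * P))) + κ′ * (q * q * P))))
      + (Q * + n * γ * (P * (m * (D * s) + (γ * (m * (D * s - q * m′)) + κ′ * - (m * q)))) + Q * + n * κ′ * (P * (+ 1 + (γ * m + κ′ * + 1))))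
      ≡⟨ ring₃ Q P (D ℤ.^ k₃ + (γ * (m * (D * (- s * q * P))) + κ′ * (q * q * P))) (+ n) γ
           (m * (D * s) + (γ * (m * (D * s - q * m′)) + κ′ * - (m * q))) κ′ (+ 1 + (γ * m + κ′ * + 1)) ⟩
    Q * P * ((D ℤ.^ k₃ + (γ * (m * (D * (- s * q * P))) + κ′ * (q * q * P)))
      + + n * (γ * (m * (D * s) + (γ * (m * (D * s - q * m′)) + κ′ * - (m * q))) + κ′ * (+ 1 + (γ * m + κ′ * + 1)))) ∎
    where
    k₃ = suc (suc (suc k))
    P  = (+ p) ℤ.^ suc k
    Q  = P ℤ.^ n
    q  = + p
    m′ = + suc (suc k)
    m  = + 1 + m′
    κ′ = κ k₃
    r  = - s * q
    α β : Vec (Fin p) k₃ → Vector ℤ k₃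
    α ξ j = D + r * u (lookup ξ j)
    β ξ j = s + s * u (lookup ξ j)
    ring₁ : ∀ D s q u t → D + s * ((+ 1 + u) * t - q * u) ≡ D + - s * q * u + (s + s * u) * t
    ring₁ = solve-∀
    ring₂ : ∀ Q A n γ M κ B → Q * (A + n * (γ * M + κ * B)) ≡ Q * A + (Q * n * γ * M + Q * n * κ * B)
    ring₂ = solve-∀
    ring₃ : ∀ Q P A n γ M κ B → Q * (P * A) + (Q * n * γ * (P * M) + Q * n * κ * (P * B)) ≡ Q * P * (A + n * (γ * M + κ * B))
    ring₃ = solve-∀
    neg-square : - s * - s ≡ + 1
    neg-square = trans (square s) s²≡1
      where
      square : ∀ s → - s * - s ≡ s * s
      square = solve-∀
    -- The even exponent removes the sign; higher powers of `r` are reduced to this one.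
    r^ : r ℤ.^ suc k ≡ P
    r^ = trans (^-distribʳ-* (- s) q (suc k)) (trans (cong (_* P) (even (- s) neg-square)) (ℤ.*-identityˡ P))
    s^ : s ℤ.^ suc k ≡ + 1
    s^ = even s s²≡1
    s^₂ : s ℤ.^ suc (suc k) ≡ s
    s^₂ = trans (cong (_*_ s) s^) (ℤ.*-identityʳ s)
    rr : ∀ x → r * (r * x) ≡ q * q * x
    rr x = trans (ring s q x) (trans (cong (λ z → z * (q * q * x)) s²≡1) (ℤ.*-identityˡ (q * q * x)))
      where
      ring : ∀ s q x → - s * q * (- s * q * x) ≡ s * s * (q * q * x)
      ring = solve-∀
    rs : ∀ x → r * (x * s) ≡ - (x * q)
    rs x = trans (ring s q x) (trans (cong (λ z → - (x * q) * z) s²≡1) (ℤ.*-identityʳ (- (x * q))))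
      where
      ring : ∀ s q x → - s * q * (x * s) ≡ - (x * q) * (s * s)
      ring = solve-∀
    const-s : prod {k₃} (λ _ → s) ≡ + 1
    const-s = trans (prod-const k₃ s) (trans (cong (_*_ s) s^₂) s²≡1)
    mixed-s : mixed {k₃} (λ _ → s) (λ _ → s) ≡ m
    mixed-s = trans (mixed-const (suc (suc k)) s s) (trans (cong (_*_ m) (trans (cong (_*_ s) s^₂) s²≡1)) (ℤ.*-identityʳ m))
    mixed-rs : mixed {k₃} (λ _ → r) (λ _ → s) ≡ - (m * q)
    mixed-rs = trans (mixed-const (suc (suc k)) r s) (trans (cong (λ z → m * (r * z)) s^₂) (trans (ring m r s) (rs m)))
      where
      ring : ∀ m r s → m * (r * s) ≡ r * (m * s)
      ring = solve-∀
    mixed₂-Drss : mixed₂ {k₃} (λ _ → D) (λ _ → r) (λ _ → s) (λ _ → s) ≡ m * (D * s - q * m′)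
    mixed₂-Drss = trans
      (sumℤ-cong (λ j → trans (mixed-update-const (suc (suc k)) j s s D r)
        (cong₂ (λ x y → D * x + r * y) s^₂ (trans (mixed-const (suc k) s s) (cong (λ z → m′ * (s * z)) s^)))))
      (trans (sumℤ-const k₃ _) (cong (_*_ m) (cong (_+_ (D * s)) (trans (ring r m′ s) (trans (rs m′) (ring′ m′ q))))))
      where
      ring : ∀ r m s → r * (m * (s * + 1)) ≡ r * (m * s)
      ring = solve-∀
      ring′ : ∀ m q → - (m * q) ≡ - (q * m)
      ring′ = solve-∀
    ∑-α : E₁ L (λ ξ → prod (α ξ)) ≡ P * (D ℤ.^ k₃ + (γ * (m * (D * (- s * q * P))) + κ′ * (q * q * P)))
    ∑-α = trans (E₁-prod L gp (λ _ → D) (λ _ → r)) (cong (_*_ P) (cong₂ _+_ (prod-const k₃ D)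
      (cong₂ (λ x y → γ * x + κ′ * y)
        (trans (mixed-const (suc (suc k)) D r) (cong (λ z → m * (D * (r * z))) r^))
        (trans (prod-const k₃ r) (trans (cong (λ z → r * (r * z)) r^) (rr P))))))
    ∑-β : E₁ L (λ ξ → prod (β ξ)) ≡ P * (+ 1 + (γ * m + κ′ * + 1))
    ∑-β = trans (E₁-prod L gp (λ _ → s) (λ _ → s)) (cong (_*_ P) (cong₂ _+_ const-s
      (cong₂ (λ x y → γ * x + κ′ * y) mixed-s const-s)))
    ∑-mixed : E₁ L (λ ξ → mixed (α ξ) (β ξ)) ≡ P * (m * (D * s) + (γ * (m * (D * s - q * m′)) + κ′ * - (m * q)))
    ∑-mixed = trans (E₁-mixed L gp (λ _ → D) (λ _ → r) (λ _ → s) (λ _ → s)) (cong (_*_ P) (cong₂ _+_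
      (trans (mixed-const (suc (suc k)) D s) (cong (λ z → m * (D * z)) s^₂))
      (cong₂ (λ x y → γ * x + κ′ * y) mixed₂-Drss mixed-rs)))

  -- Apart from its top power, every occurrence of `D` carries an odd power of `s` and cancels
  -- between the two signs. What is left of `g` is a constant independent of `D`; its factor `suc k`
  -- is the number of columns minus two.
  E-both : ∀ (L : LinearSystem 2 (suc (suc (suc k)))) → GeneralPosition L → SignPower (suc k) → ∀ D →
    let N  = p ℕ.^ suc k
        P  = (+ p) ℤ.^ suc k
        q  = + p
    in E (suc N) L (λ x → prod (λ j → D + g (lookup x j))) + E (suc N) L (λ x → prod (λ j → D - g (lookup x j))) ≡
       + 2 * (P ℤ.^ suc N * (D ℤ.^ suc (suc (suc k)) - q * q * P * (+ suc k * (q * q - + 1))))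
  E-both {k} L gp even D = begin
    E (suc N) L (λ x → prod (λ j → D + g (lookup x j))) + E (suc N) L (λ x → prod (λ j → D - g (lookup x j)))
      ≡⟨ cong₂ _+_
           (E-cong (suc N) L (λ x → prod-cong (λ j → ring₁ D (g (lookup x j)))))
           (E-cong (suc N) L (λ x → prod-cong (λ j → ring₂ D (g (lookup x j))))) ⟩
    E (suc N) L (λ x → prod (λ j → D + + 1 * g (lookup x j))) + E (suc N) L (λ x → prod (λ j → D + - (+ 1) * g (lookup x j)))
      ≡⟨ cong₂ _+_ (E-shifted N L gp even D (+ 1) refl) (E-shifted N L gp even D (- (+ 1)) refl) ⟩
    P ℤ.^ N * P * value (+ 1) (+ N) + P ℤ.^ N * P * value (- (+ 1)) (+ N)
      ≡⟨ cong (λ z → P ℤ.^ N * P * value (+ 1) z + P ℤ.^ N * P * value (- (+ 1)) z) (pos-^ p (suc k)) ⟩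
    P ℤ.^ N * P * value (+ 1) P + P ℤ.^ N * P * value (- (+ 1)) P
      ≡⟨ ring₃ (P ℤ.^ N) P (D ℤ.^ suc (suc (suc k))) D q (+ suc k) ⟩
    + 2 * (P ℤ.^ suc N * (D ℤ.^ suc (suc (suc k)) - q * q * P * (+ suc k * (q * q - + 1)))) ∎
    where
    N  = p ℕ.^ suc k
    P  = (+ p) ℤ.^ suc k
    q  = + p
    m′ = + suc (suc k)
    m  = + 1 + m′
    κ′ = κ (suc (suc (suc k)))
    value : ℤ → ℤ → ℤ
    value s n = (D ℤ.^ suc (suc (suc k)) + (γ * (m * (D * (- s * q * P))) + κ′ * (q * q * P)))
      + n * (γ * (m * (D * s) + (γ * (m * (D * s - q * m′)) + κ′ * - (m * q))) + κ′ * (+ 1 + (γ * m + κ′ * + 1)))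
    ring₁ : ∀ D g → D + g ≡ D + + 1 * g
    ring₁ = solve-∀
    ring₂ : ∀ D g → D - g ≡ D + - (+ 1) * g
    ring₂ = solve-∀
    ring₃ : ∀ Q P D₃ D q l →
      let m′ = + 1 + l
          m  = + 1 + m′
          γ  = q - + 1
          κ′ = q * q - + 1 - m * (q - + 1)
      in Q * P * ((D₃ + (γ * (m * (D * (- (+ 1) * q * P))) + κ′ * (q * q * P)))
             + P * (γ * (m * (D * + 1) + (γ * (m * (D * + 1 - q * m′)) + κ′ * - (m * q))) + κ′ * (+ 1 + (γ * m + κ′ * + 1))))
         + Q * P * ((D₃ + (γ * (m * (D * (- (- (+ 1)) * q * P))) + κ′ * (q * q * P)))
             + P * (γ * (m * (D * - (+ 1)) + (γ * (m * (D * - (+ 1) - q * m′)) + κ′ * - (m * q))) + κ′ * (+ 1 + (γ * m + κ′ * + 1))))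
         ≡ + 2 * (P * Q * (D₃ - q * q * P * (l * (q * q - + 1))))
    ring₃ = solve-∀

  -- A nonzero integer of absolute value below `p` is not divisible by `p`. A column vanishing
  -- modulo `p` would make its minor with any `other` column divisible by `p`.
  minors⇒generalPosition : ∀ (L : LinearSystem 2 (suc (suc k))) → (∀ i j → i ≢ j → minor L i j ≢ + 0) →
    (∀ i j → ℤ.∣ minor L i j ∣ ℕ.< p) → GeneralPosition L
  minors⇒generalPosition {k} L minor≢0 minor<p = generalPosition
    (λ j (p∣₀ , p∣₁) → p∤minor j (other j) (j≢other j)
      (∣m∣n⇒∣m-n (∣m⇒∣m*n (L 1F (other j)) p∣₀) (∣m⇒∣m*n (L 0F (other j)) p∣₁)))
    p∤minor
    where
    p∤minor : ∀ i j → i ≢ j → ¬ + p ∣ℤ minor L i j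
    p∤minor i j i≢j p∣ = ℕ.<⇒≱ (minor<p i j)
      (ℕ.∣⇒≤ {{ℕ.≢-nonZero (minor≢0 i j i≢j ∘ ℤ.∣i∣≡0⇒i≡0)}} (∣⇒∣ᵤ p∣))
    other : Fin (suc (suc k)) → Fin (suc (suc k))
    other zero    = suc zero
    other (suc _) = zero
    j≢other : ∀ j → j ≢ other j
    j≢other zero    ()
    j≢other (suc _) ()

  -- Size bounds, densities as integer sums, and the contradiction.

  ∣u∣≤p : ∀ c → ℤ.∣ u c ∣ ℕ.≤ p
  ∣u∣≤p = bound p
    where
    bound : ∀ q (c : Fin q) → ℤ.∣ + q * δ c - + 1 ∣ ℕ.≤ q
    bound (suc q) zero    = subst (λ z → ℤ.∣ z - + 1 ∣ ℕ.≤ suc q) (sym (ℤ.*-identityʳ (+ suc q))) (ℕ.n≤1+n q)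
    bound (suc q) (suc _) = subst (λ z → ℤ.∣ z - + 1 ∣ ℕ.≤ suc q) (sym (ℤ.*-zeroʳ (+ suc q))) (ℕ.s≤s ℕ.z≤n)

  ∣total∣≤ : ∀ (x : 𝔽^ p n) → ℤ.∣ total x ∣ ℕ.≤ n ℕ.* p
  ∣total∣≤ []      = ℕ.z≤n
  ∣total∣≤ (c ∷ x) = ℕ.≤-trans (ℤ.∣i+j∣≤∣i∣+∣j∣ (u c) (total x)) (ℕ.+-mono-≤ (∣u∣≤p c) (∣total∣≤ x))

  ∣g∣≤ : ∀ (v : 𝔽^ p (suc n)) → ℤ.∣ g v ∣ ℕ.≤ suc p ℕ.* (n ℕ.* p) ℕ.+ p ℕ.* p
  ∣g∣≤ {n} (y ∷ x) = ℕ.≤-trans (ℤ.∣i-j∣≤∣i∣+∣j∣ ((+ 1 + u y) * total x) (+ p * u y)) (ℕ.+-mono-≤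
    (subst (ℕ._≤ suc p ℕ.* (n ℕ.* p)) (sym (ℤ.abs-* (+ 1 + u y) (total x)))
      (ℕ.*-mono-≤ (ℕ.≤-trans (ℤ.∣i+j∣≤∣i∣+∣j∣ (+ 1) (u y)) (ℕ.s≤s (∣u∣≤p y))) (∣total∣≤ x)))
    (subst (ℕ._≤ p ℕ.* p) (sym (ℤ.abs-* (+ p) (u y))) (ℕ.*-monoʳ-≤ p (∣u∣≤p y))))

  E-one : ∀ n (L : LinearSystem 2 (suc (suc (suc k)))) → GeneralPosition L → E n L (λ _ → + 1) ≡ ((+ p) ℤ.^ suc k) ℤ.^ n
  E-one {k} n L gp = begin
    E n L (λ _ → + 1)
      ≡⟨ E-cong n L (λ x → sym (trans (prod-cong (λ j → ring₁ (total (lookup x j)))) (trans (prod-const k₃ (+ 1)) (ℤ.^-zeroˡ k₃)))) ⟩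
    E n L (λ x → prod (λ j → + 1 + + 0 * total (lookup x j)))
      ≡⟨ E-prod n L gp (λ _ → + 1) (λ _ → + 0) ⟩
    P ℤ.^ n * (prod {k₃} (λ _ → + 1) + + n * K {k₃} (λ _ → + 1) (λ _ → + 0))
      ≡⟨ cong (λ x → P ℤ.^ n * (x + + n * K {k₃} (λ _ → + 1) (λ _ → + 0))) (trans (prod-const k₃ (+ 1)) (ℤ.^-zeroˡ k₃)) ⟩
    P ℤ.^ n * (+ 1 + + n * (γ * + 0 + κ k₃ * + 0))
      ≡⟨ ring₂ (P ℤ.^ n) (+ n) γ (κ k₃) ⟩
    P ℤ.^ n ∎
    where
    k₃ = suc (suc (suc k))
    P = (+ p) ℤ.^ suc k
    ring₁ : ∀ t → + 1 + + 0 * t ≡ + 1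
    ring₁ = solve-∀
    ring₂ : ∀ P n γ κ → P * (+ 1 + n * (γ * + 0 + κ * + 0)) ≡ P
    ring₂ = solve-∀

  length-solutions : ∀ n (L : LinearSystem 2 k) → + List.length (solutions L p n) ≡ E n L (λ _ → + 1)
  length-solutions {k} n L = trans (sym (trans (∑-const (solutions L p n) (+ 1)) (ℤ.*-identityʳ _)))
    (∑-filter (isSolution? L) (allVecs (cube n) k) (λ _ → + 1))

  -- The density is multiplied by `c` once for each of the k factors and by the number of solutions,
  -- so that only an integer sum remains.
  seq-t : ∀ (L : LinearSystem 2 k) c (f : 𝔽^ p n → ℝ) (z : 𝔽^ p n → ℤ) i → (∀ a → fromℤ c ℚ.* seq (f a) i ≡ fromℤ (z a)) →
    fromℤ (c ℤ.^ k) ℚ.* (fromℤ (E n L (λ _ → + 1)) ℚ.* seq (t L f) i) ≡ fromℤ (E n L (λ x → prod (λ j → z (lookup x j))))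
  seq-t {k} {n} L c f z i scaled = begin
    scale ℚ.* (fromℤ (E n L (λ _ → + 1)) ℚ.* seq (t L f) i)
      ≡⟨ cong (λ m → scale ℚ.* (fromℤ m ℚ.* seq (t L f) i)) (trans (sym (length-solutions n L)) (cong +_ (sym (length-map F (solutions L p n))))) ⟩
    scale ℚ.* (fromℤ (+ List.length (List.map F (solutions L p n))) ℚ.* seq (t L f) i)
      ≡⟨ cong (ℚ._*_ scale) (seq-average (List.map F (solutions L p n)) i) ⟩
    scale ℚ.* seq (sumᴿ (List.map F (solutions L p n))) i
      ≡⟨ seq-sum {c = c ℤ.^ k} F Z i (seq-product {c = c} f z i scaled) (solutions L p n) ⟩
    fromℤ (∑ (solutions L p n) Z)
      ≡⟨ cong fromℤ (∑-filter (isSolution? L) (allVecs (cube n) k) Z) ⟩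
    fromℤ (E n L Z) ∎
    where
    scale = fromℤ (c ℤ.^ k)
    F : Vec (𝔽^ p n) k → ℝ
    F x = productᴿ (Vec.toList (Vec.map f x))
    Z : Vec (𝔽^ p n) k → ℤ
    Z x = prod (λ j → z (lookup x j))

  uncommon : ∀ (L : LinearSystem 2 (suc (suc (suc k)))) → GeneralPosition L → SignPower (suc k) → Uncommon p L
  uncommon {k} L gp even common = ℤ.<⇒≱ gap (fromℤ-cancel-≤ (subst₂ ℚ._≤_ lhs-eq rhs-eq (ℚ.*-monoˡ-≤-nonNeg (fromℤ G) a≤y₀)))
    where
    k₃ = suc (suc (suc k))
    N  = p ℕ.^ suc k
    P  = (+ p) ℤ.^ suc k
    -- One more than the bound on the absolute value of `g`: this keeps `h` between 0 and 1 and the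
    -- denominator visibly nonzero. Its size is harmless, as `X` does not involve it.
    d  = suc (suc p ℕ.* (N ℕ.* p) ℕ.+ p ℕ.* p)
    D  = + d
    c  = + (2 ℕ.* d)
    M  = E (suc N) L (λ _ → + 1)
    E₊ = E (suc N) L (λ x → prod (λ j → D + g (lookup x j)))
    E₋ = E (suc N) L (λ x → prod (λ j → D - g (lookup x j)))
    X  = + p * + p * P * (+ suc k * (+ p * + p - + 1))
    G  = c ℤ.^ k₃ * M

    h : 𝔽^ p (suc N) → ℚ
    h v = (D + g v) ℚ./ (2 ℕ.* d)

    f f̄ : 𝔽^ p (suc N) → ℝ
    f v = fromℚ (h v)
    f̄ v = 1ᴿ -ᴿ f v

    scaled₊ : ∀ v → fromℤ c ℚ.* h v ≡ fromℤ (D + g v)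
    scaled₊ v = fromℤ-*-/ (D + g v) (2 ℕ.* d)

    scaled₋ : ∀ v → fromℤ c ℚ.* (1ℚ ℚ.- h v) ≡ fromℤ (D - g v)
    scaled₋ v = begin
      fromℤ c ℚ.* (1ℚ ℚ.- h v)            ≡⟨ ring (fromℤ c) (h v) ⟩
      fromℤ c ℚ.- fromℤ c ℚ.* h v         ≡⟨ cong (ℚ._-_ (fromℤ c)) (scaled₊ v) ⟩
      fromℤ c ℚ.- fromℤ (D + g v)         ≡⟨ fromℤ-homo-- c (D + g v) ⟨
      fromℤ (c - (D + g v))               ≡⟨ cong fromℤ (trans (cong (_- (D + g v)) (ℤ.pos-* 2 d)) (ring′ D (g v))) ⟩
      fromℤ (D - g v)                     ∎
      where
      open +-*-Solver
      ring : ∀ c h → c ℚ.* (1ℚ ℚ.- h) ≡ c ℚ.- c ℚ.* h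
      ring = solve 2 (λ c h → c :* (con 1ℚ :- h) := c :- c :* h) refl
      ring′ : ∀ D g → + 2 * D - (D + g) ≡ D - g
      ring′ = solve-∀

    0<p : + 0 ℤ.< + p
    0<p = ℤ.+<+ (ℕ.>-nonZero⁻¹ p)

    0<c : + 0 ℤ.< c
    0<c = ℤ.+<+ (ℕ.s≤s ℕ.z≤n)

    M≡ : M ≡ P ℤ.^ suc N
    M≡ = E-one (suc N) L gp

    0<M : + 0 ℤ.< M
    0<M = subst (+ 0 ℤ.<_) (sym M≡) (0<^ (suc N) (0<^ (suc k) 0<p))

    fromℤ-positive : ∀ {z} → + 0 ℤ.< z → ℚ.Positive (fromℤ z)
    fromℤ-positive {z} 0<z = ℚ.positive (ℚ.≰⇒> (λ z≤0 → ℤ.<⇒≱ 0<z (fromℤ-cancel-≤ {z} {+ 0} z≤0)))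

    instance
      c-positive : ℚ.Positive (fromℤ c)
      c-positive = fromℤ-positive 0<c
      G-positive : ℚ.Positive (fromℤ G)
      G-positive = fromℤ-positive (0<* (0<^ k₃ 0<c) 0<M)
      G-nonNeg : ℚ.NonNegative (fromℤ G)
      G-nonNeg = ℚ.pos⇒nonNeg (fromℤ G)

    0≤h : ∀ v → 0ℚ ℚ.≤ h v
    0≤h v = ℚ.*-cancelˡ-≤-pos (fromℤ c) (subst₂ ℚ._≤_ (sym (ℚ.*-zeroʳ (fromℤ c))) (sym (scaled₊ v))
      (fromℤ-mono-≤ (∣i∣≤n⇒0≤n+i (g v) (ℕ.m≤n⇒m≤1+n (∣g∣≤ v)))))

    h≤1 : ∀ v → h v ℚ.≤ 1ℚ
    h≤1 v = subst₂ ℚ._≤_ (ring₁ (h v)) (ring₂ (h v)) (ℚ.+-monoʳ-≤ (h v)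
      (ℚ.*-cancelˡ-≤-pos {0ℚ} {1ℚ ℚ.- h v} (fromℤ c) (subst₂ ℚ._≤_ (sym (ℚ.*-zeroʳ (fromℤ c))) (sym (scaled₋ v))
        (fromℤ-mono-≤ (∣i∣≤n⇒0≤n-i (g v) (ℕ.m≤n⇒m≤1+n (∣g∣≤ v)))))))
      where
      open +-*-Solver
      ring₁ : ∀ h → h ℚ.+ 0ℚ ≡ h
      ring₁ = ℚ.+-identityʳ
      ring₂ : ∀ h → h ℚ.+ (1ℚ ℚ.- h) ≡ 1ℚ
      ring₂ = solve 1 (λ h → h :+ (con 1ℚ :- h) := con 1ℚ) refl

    ≤+ε : ∀ {x y} → x ℚ.≤ y → ∀ ε → 0ℚ ℚ.< ε → x ℚ.≤ y ℚ.+ ε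
    ≤+ε {x} {y} x≤y ε 0<ε = subst (ℚ._≤ y ℚ.+ ε) (ℚ.+-identityʳ x) (ℚ.+-mono-≤ x≤y (ℚ.<⇒≤ 0<ε))

    y : ℕ → ℚ
    y i = seq (t L f) i ℚ.+ seq (t L f̄) i

    Gy : ∀ i → fromℤ G ℚ.* y i ≡ fromℤ (E₊ + E₋)
    Gy i = begin
      fromℤ G ℚ.* y i
        ≡⟨ cong (ℚ._* y i) (fromℤ-homo-* (c ℤ.^ k₃) M) ⟩
      fromℤ (c ℤ.^ k₃) ℚ.* fromℤ M ℚ.* (seq (t L f) i ℚ.+ seq (t L f̄) i)
        ≡⟨ ring (fromℤ (c ℤ.^ k₃)) (fromℤ M) (seq (t L f) i) (seq (t L f̄) i) ⟩
      fromℤ (c ℤ.^ k₃) ℚ.* (fromℤ M ℚ.* seq (t L f) i) ℚ.+ fromℤ (c ℤ.^ k₃) ℚ.* (fromℤ M ℚ.* seq (t L f̄) i)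
        ≡⟨ cong₂ ℚ._+_ (seq-t L c f (λ v → D + g v) i scaled₊) (seq-t L c f̄ (λ v → D - g v) i scaled₋) ⟩
      fromℤ E₊ ℚ.+ fromℤ E₋
        ≡⟨ fromℤ-homo-+ E₊ E₋ ⟨
      fromℤ (E₊ + E₋) ∎
      where
      open +-*-Solver
      ring : ∀ a b x y → a ℚ.* b ℚ.* (x ℚ.+ y) ≡ a ℚ.* (b ℚ.* x) ℚ.+ a ℚ.* (b ℚ.* y)
      ring = solve 4 (λ a b x y → a :* b :* (x :+ y) := a :* (b :* x) :+ a :* (b :* y)) refl

    -- The values of `f` are rational constants, so after scaling by `G` every index gives the same
    -- integer. The inequality with ε, granted only from some index on, thus holds at index 0 for
    -- every ε.
    y≤y₀ : ∀ i → y i ℚ.≤ y 0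
    y≤y₀ i = ℚ.*-cancelˡ-≤-pos (fromℤ G) (ℚ.≤-reflexive (trans (Gy i) (sym (Gy 0))))

    a≤y₀ : 2^[1- k₃ ] ℚ.≤ y 0
    a≤y₀ = ≤+ε⇒≤ (λ ε 0<ε → let i , le = c≤t ε 0<ε in ℚ.≤-trans (le i ℕ.≤-refl) (ℚ.+-monoˡ-≤ ε (y≤y₀ i)))
      where
      c≤t : fromℚ 2^[1- k₃ ] ≤ᴿ t L f +ᴿ t L f̄
      c≤t = common (suc N) f (λ v → (λ ε 0<ε → 0 , λ _ _ → ≤+ε (0≤h v) ε 0<ε) , (λ ε 0<ε → 0 , λ _ _ → ≤+ε (h≤1 v) ε 0<ε))

    lhs-eq : fromℤ G ℚ.* 2^[1- k₃ ] ≡ fromℤ (+ 2 * (M * D ℤ.^ k₃))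
    lhs-eq = begin
      fromℤ G ℚ.* 2^[1- k₃ ]
        ≡⟨ cong (λ z → fromℤ z ℚ.* 2^[1- k₃ ]) G-eq ⟩
      fromℤ (M * D ℤ.^ k₃ * + (2 ℕ.^ k₃)) ℚ.* 2^[1- k₃ ]
        ≡⟨ cong (ℚ._* 2^[1- k₃ ]) (fromℤ-homo-* (M * D ℤ.^ k₃) (+ (2 ℕ.^ k₃))) ⟩
      fromℤ (M * D ℤ.^ k₃) ℚ.* fromℤ (+ (2 ℕ.^ k₃)) ℚ.* 2^[1- k₃ ]
        ≡⟨ ℚ.*-assoc (fromℤ (M * D ℤ.^ k₃)) (fromℤ (+ (2 ℕ.^ k₃))) 2^[1- k₃ ] ⟩
      fromℤ (M * D ℤ.^ k₃) ℚ.* (fromℤ (+ (2 ℕ.^ k₃)) ℚ.* 2^[1- k₃ ])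
        ≡⟨ cong (ℚ._*_ (fromℤ (M * D ℤ.^ k₃))) (fromℤ-*-/ (+ 2) (2 ℕ.^ k₃) {{ℕ.m^n≢0 2 k₃}}) ⟩
      fromℤ (M * D ℤ.^ k₃) ℚ.* fromℤ (+ 2)
        ≡⟨ fromℤ-homo-* (M * D ℤ.^ k₃) (+ 2) ⟨
      fromℤ (M * D ℤ.^ k₃ * + 2)
        ≡⟨ cong fromℤ (ℤ.*-comm (M * D ℤ.^ k₃) (+ 2)) ⟩
      fromℤ (+ 2 * (M * D ℤ.^ k₃)) ∎
      where
      ring : ∀ t D M → t * D * M ≡ M * D * t
      ring = solve-∀
      G-eq : G ≡ M * D ℤ.^ k₃ * + (2 ℕ.^ k₃)
      G-eq = begin
        c ℤ.^ k₃ * M                         ≡⟨ cong (λ z → z ℤ.^ k₃ * M) (ℤ.pos-* 2 d) ⟩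
        (+ 2 * D) ℤ.^ k₃ * M                 ≡⟨ cong (_* M) (^-distribʳ-* (+ 2) D k₃) ⟩
        (+ 2) ℤ.^ k₃ * D ℤ.^ k₃ * M          ≡⟨ ring ((+ 2) ℤ.^ k₃) (D ℤ.^ k₃) M ⟩
        M * D ℤ.^ k₃ * (+ 2) ℤ.^ k₃          ≡⟨ cong (_*_ (M * D ℤ.^ k₃)) (pos-^ 2 k₃) ⟨
        M * D ℤ.^ k₃ * + (2 ℕ.^ k₃)          ∎

    rhs-eq : fromℤ G ℚ.* y 0 ≡ fromℤ (+ 2 * (M * (D ℤ.^ k₃ - X)))
    rhs-eq = trans (Gy 0) (cong fromℤ (trans (E-both L gp even D) (cong (λ z → + 2 * (z * (D ℤ.^ k₃ - X))) (sym M≡))))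

    0<X : + 0 ℤ.< X
    0<X = 0<* (0<* (0<* 0<p 0<p) (0<^ (suc k) 0<p)) (0<* {+ suc k} (ℤ.+<+ (ℕ.s≤s ℕ.z≤n)) (0<n²-1 p {{prime⇒nonTrivial p-prime}}))

    gap : + 2 * (M * (D ℤ.^ k₃ - X)) ℤ.< + 2 * (M * D ℤ.^ k₃)
    -- Commonness would give the reverse inequality between the scaled sum of densities on the left
    -- and the scaled random value on the right.
    gap = subst₂ ℤ._<_ (ℤ.+-identityʳ _) (ring M (D ℤ.^ k₃) X)
      (ℤ.+-monoʳ-< (+ 2 * (M * (D ℤ.^ k₃ - X))) (0<* {+ 2} (ℤ.+<+ (ℕ.s≤s ℕ.z≤n)) (0<* 0<M 0<X)))
      where
      ring : ∀ M D X → + 2 * (M * (D - X)) + + 2 * (M * X) ≡ + 2 * (M * D)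
      ring = solve-∀

-- Evenness, and the choice of the threshold.

square≡1⇒even-power≡1 : ∀ s q → s * s ≡ + 1 → s ℤ.^ (q ℕ.* 2) ≡ + 1
square≡1⇒even-power≡1 s zero    s²≡1 = refl
square≡1⇒even-power≡1 s (suc q) s²≡1 = begin
  s * (s * s ℤ.^ (q ℕ.* 2))  ≡⟨ cong (λ z → s * (s * z)) (square≡1⇒even-power≡1 s q s²≡1) ⟩
  s * (s * + 1)              ≡⟨ cong (_*_ s) (ℤ.*-identityʳ s) ⟩
  s * s                      ≡⟨ s²≡1 ⟩
  + 1                        ∎

theorem1p8 : ∀ (k : ℕ) → 4 ≤ k → 2 ∣ k →
    (L : LinearSystem 2 k) → Irredundant L → HasGirth L (k ∸ 1) →
    ∃[ pL ] (∀ p → Prime p → pL ≤ p → Uncommon p L)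
theorem1p8 (suc zero) (ℕ.s≤s ())
theorem1p8 (suc (suc zero)) (ℕ.s≤s (ℕ.s≤s ()))
theorem1p8 (suc (suc (suc zero))) (ℕ.s≤s (ℕ.s≤s (ℕ.s≤s ())))
theorem1p8 (suc (suc (suc (suc k)))) _ (ℕ.divides zero ()) L irr girth
theorem1p8 (suc (suc (suc (suc k)))) _ (ℕ.divides (suc zero) ()) L irr girth
theorem1p8 (suc (suc (suc (suc k)))) _ (ℕ.divides (suc (suc q)) k≡) L irr girth =
  -- One above a bound for all minors, so that no nonzero minor is divisible by a prime from here
  -- on.
  suc (proj₁ (minors-bounded L)) , λ p p-prime B<p →
    let open Modular p p-prime in uncommon L
         (minors⇒generalPosition L (girth⇒minor≢0 L irr girth) (λ i j → ℕ.≤-<-trans (proj₂ (minors-bounded L) i j) B<p))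
         (λ s s²≡1 → trans (cong (s ℤ.^_) even) (square≡1⇒even-power≡1 s (suc q) s²≡1))
  where
  even : suc (suc k) ≡ suc q ℕ.* 2
  even = ℕ.suc-injective (ℕ.suc-injective k≡)
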